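{- Let $n\ge 4$ and $1\le p\le n-3$ be integers, let $a$ be a real number with $a>1$ or $0<a\le e^{ -1}$, and let $m=\lfloor \frac{2n-p}{n-p}\rfloor$ and $t=2n-p-m(n-p)$. Then for every unicyclic graph $G$ with $n$ vertices and exactly $p$ pendant vertices, $$ t(m+1)a^{m+1} + (n-p-t)\, m\, a^{m} + p a \le SEI_a(G) \le (p+2)a^{p+2} + (n-p-1)\,2a^2 + p a, $$ and both inequalities are attained (i.e., for each such $n,p,a$, each of the two bounds is equal to $SEI_a(G)$ for some unicyclic graph $G$ with $n$ vertices and $p$ pendant vertices).
   Context: All graphs are finite, connected, simple (no loops, no multiple edges) and have at least one edge. A unicyclic graph is a graph containing exactly one cycle. A vertex is pendant if it has degree $1$. For a vertex $u$ of $G$, $d_u$ denotes its degree. For a positive real number $a\ne 1$, the variable sum exdeg index is $SEI_a(G)=\sum_{uv\in E(G)}(a^{d_u}+a^{d_v})=\sum_{u\in V(G)} d_u a^{d_u}$. -}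

module Defs where

open import Algebra.Bundles.Raw using (RawSemiring)
open import Data.Empty using (⊥-elim)
open import Data.Fin.Base using (Fin)
import Data.Fin.Properties as Fin
open import Data.Integer.Base using (+_; +≤+)
import Data.Integer.Base as ℤ
import Data.Integer.Properties as ℤ
open import Data.List.Base
  using (List; []; _∷_; _∷ʳ_; allFin; cartesianProduct; filter; foldr; length; map; zip)
open import Data.List.Membership.Propositional using (_∈_)
open import Data.List.Relation.Unary.Linked using (Linked)
open import Data.List.Relation.Unary.Unique.Propositional using (Unique)
open import Data.Nat.Base using (ℕ; zero; suc; NonZero; _!; s≤s; z≤n)
import Data.Nat.Base as ℕ
import Data.Nat.Properties as ℕ
open import Data.Product.Base using (∃-syntax; _×_; _,_; proj₁; proj₂)
open import Data.Rational.Base renaming (NonZero to ℚNonZero)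
open import Data.Rational.Properties
open import Data.Rational.Solver using (module +-*-Solver)
import Data.Rational.Unnormalised.Base as ℚᵘ
import Data.Rational.Unnormalised.Properties as ℚᵘ
open import Data.Sum.Base using (_⊎_; inj₁; inj₂)
open import Function.Bundles using (_⇔_)
open import Level using (0ℓ)
open import Relation.Binary.Construct.Closure.ReflexiveTransitive using (Star)
open import Relation.Binary.Core using (Rel)
open import Relation.Binary.Definitions using (Decidable; Irreflexive; Symmetric)
open import Relation.Binary.PropositionalEquality
  using (_≡_; refl; sym; trans; cong; cong₂; subst)
open import Relation.Nullary.Decidable using (_×-dec_)

------------------------------------------------------------------------
-- Real numbers: Cauchy sequences of rationals, up to _≈ℝ_

IsCauchy : (ℕ → ℚ) → Set
IsCauchy x = ∀ ε → 0ℚ < ε →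
  ∃[ N ] (∀ m n → N ℕ.≤ m → N ℕ.≤ n → ∣ x m - x n ∣ < ε)

record ℝ : Set where
  constructor mkℝ
  field
    seq      : ℕ → ℚ
    isCauchy : IsCauchy seq

open ℝ public

infix 4 _≈ℝ_ _≤ℝ_ _<ℝ_

_≈ℝ_ : Rel ℝ 0ℓ
x ≈ℝ y = ∀ ε → 0ℚ < ε → ∃[ N ] (∀ n → N ℕ.≤ n → ∣ seq x n - seq y n ∣ < ε)

_≤ℝ_ : Rel ℝ 0ℓ
x ≤ℝ y = ∀ ε → 0ℚ < ε → ∃[ N ] (∀ n → N ℕ.≤ n → seq x n < seq y n + ε)

_<ℝ_ : Rel ℝ 0ℓ
x <ℝ y = ∃[ δ ] (0ℚ < δ × ∃[ N ] (∀ n → N ℕ.≤ n → seq x n + δ ≤ seq y n))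

module CauchyLemmas where
  ½*-pos : ∀ {ε} → 0ℚ < ε → 0ℚ < ½ * ε
  ½*-pos {ε} 0<ε = subst (_< ½ * ε) (*-zeroʳ ½) (*-monoʳ-<-pos ½ 0<ε)

  ½+½ : ∀ ε → ½ * ε + ½ * ε ≡ ε
  ½+½ ε = trans (sym (*-distribʳ-+ ε ½ ½)) (*-identityˡ ε)

  *-pos : ∀ {p q} → 0ℚ < p → 0ℚ < q → 0ℚ < p * q
  *-pos {p} {q} 0<p 0<q =
    subst (_< p * q) (*-zeroʳ p) (*-monoʳ-<-pos p {{positive 0<p}} 0<q)

  ∣-∣-comm : ∀ p q → ∣ p - q ∣ ≡ ∣ q - p ∣
  ∣-∣-comm p q = trans (cong ∣_∣ (lem p q)) (∣-p∣≡∣p∣ (q - p))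
    where
    open +-*-Solver
    lem : ∀ p q → p - q ≡ - (q - p)
    lem = solve 2 (λ p q → p :- q := :- (q :- p)) refl

  p≤q⇒0≤q-p : ∀ {p q} → p ≤ q → 0ℚ ≤ q - p
  p≤q⇒0≤q-p {p} {q} p≤q = subst (_≤ q - p) (+-inverseʳ p) (+-monoˡ-≤ (- p) p≤q)

  const-isCauchy : ∀ q → IsCauchy (λ _ → q)
  const-isCauchy q ε 0<ε = 0 , λ _ _ _ _ →
    subst (_< ε) (sym (cong ∣_∣ (+-inverseʳ q))) 0<ε

  +-isCauchy : ∀ {x y} → IsCauchy x → IsCauchy y → IsCauchy (λ n → x n + y n)
  +-isCauchy {x} {y} cx cy ε 0<ε = Nx ℕ.⊔ Ny , bound
    where
    hx = cx (½ * ε) (½*-pos 0<ε)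
    hy = cy (½ * ε) (½*-pos 0<ε)
    Nx = proj₁ hx
    Ny = proj₁ hy
    rearrange : ∀ p q r s → (p + r) - (q + s) ≡ (p - q) + (r - s)
    rearrange = solve 4 (λ p q r s →
      (p :+ r) :- (q :+ s) := (p :- q) :+ (r :- s)) refl
      where open +-*-Solver
    bound : ∀ m n → Nx ℕ.⊔ Ny ℕ.≤ m → Nx ℕ.⊔ Ny ℕ.≤ n →
            ∣ (x m + y m) - (x n + y n) ∣ < ε
    bound m n N≤m N≤n = begin-strict
      ∣ (x m + y m) - (x n + y n) ∣     ≡⟨ cong ∣_∣ (rearrange (x m) (x n) (y m) (y n)) ⟩
      ∣ (x m - x n) + (y m - y n) ∣     ≤⟨ ∣p+q∣≤∣p∣+∣q∣ (x m - x n) (y m - y n) ⟩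
      ∣ x m - x n ∣ + ∣ y m - y n ∣     <⟨ +-mono-<
        (proj₂ hx m n (ℕ.m⊔n≤o⇒m≤o Nx Ny N≤m) (ℕ.m⊔n≤o⇒m≤o Nx Ny N≤n))
        (proj₂ hy m n (ℕ.m⊔n≤o⇒n≤o Nx Ny N≤m) (ℕ.m⊔n≤o⇒n≤o Nx Ny N≤n)) ⟩
      ½ * ε + ½ * ε                     ≡⟨ ½+½ ε ⟩
      ε                                 ∎
      where open ≤-Reasoning

  eventually-bounded : ∀ {x} → IsCauchy x →
    ∃[ B ] (0ℚ < B × ∃[ N ] (∀ n → N ℕ.≤ n → ∣ x n ∣ ≤ B))
  eventually-bounded {x} cx = 1ℚ + ∣ x N ∣ , 0<B , N , bound
    where
    h = cx 1ℚ (positive⁻¹ 1ℚ)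
    N = proj₁ h
    0<B : 0ℚ < 1ℚ + ∣ x N ∣
    0<B = +-mono-<-≤ (positive⁻¹ 1ℚ) (0≤∣p∣ (x N))
    split : ∀ p q → p ≡ (p - q) + q
    split = solve 2 (λ p q → p := (p :- q) :+ q) refl
      where open +-*-Solver
    bound : ∀ n → N ℕ.≤ n → ∣ x n ∣ ≤ 1ℚ + ∣ x N ∣
    bound n N≤n = begin
      ∣ x n ∣                  ≡⟨ cong ∣_∣ (split (x n) (x N)) ⟩
      ∣ (x n - x N) + x N ∣    ≤⟨ ∣p+q∣≤∣p∣+∣q∣ (x n - x N) (x N) ⟩
      ∣ x n - x N ∣ + ∣ x N ∣  ≤⟨ +-monoˡ-≤ ∣ x N ∣ (<⇒≤ (proj₂ h n N N≤n ℕ.≤-refl)) ⟩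
      1ℚ + ∣ x N ∣             ∎
      where open ≤-Reasoning

  divide : ∀ {ε B} → 0ℚ < ε → 0ℚ < B → ∃[ δ ] (0ℚ < δ × B * δ ≡ ε)
  divide {ε} {B} 0<ε 0<B = 1/B * ε , *-pos (positive⁻¹ 1/B {{1/pos⇒pos B}}) 0<ε , eq
    where
    instance
      B-pos : Positive B
      B-pos = positive 0<B
      B≢0 : ℚNonZero B
      B≢0 = pos⇒nonZero B
    1/B = 1/ B
    eq : B * (1/B * ε) ≡ ε
    eq = trans (sym (*-assoc B 1/B ε))
               (trans (cong (_* ε) (*-inverseʳ B)) (*-identityˡ ε))

  *-isCauchy : ∀ {x y} → IsCauchy x → IsCauchy y → IsCauchy (λ n → x n * y n)
  *-isCauchy {x} {y} cx cy ε 0<ε =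
    let (A , 0<A , K , x≤A) = eventually-bounded cx
        (B , 0<B , L , y≤B) = eventually-bounded cy
        (α , 0<α , Aα≡½ε)   = divide (½*-pos 0<ε) 0<A
        (β , 0<β , Bβ≡½ε)   = divide (½*-pos 0<ε) 0<B
        (P , y-close)       = cy α 0<α
        (Q , x-close)       = cx β 0<β
    in (K ℕ.⊔ L) ℕ.⊔ (P ℕ.⊔ Q) ,
       bound A B K L α β P Q 0<A 0<B x≤A y≤B Aα≡½ε Bβ≡½ε y-close x-close
    where
    rearrange : ∀ p q r s → p * r - q * s ≡ p * (r - s) + s * (p - q)
    rearrange = solve 4 (λ p q r s →
      p :* r :- q :* s := p :* (r :- s) :+ s :* (p :- q)) refl
      where open +-*-Solver
    product-bound : ∀ {u v C γ} → 0ℚ < C → ∣ u ∣ ≤ C → ∣ v ∣ < γ → ∣ u * v ∣ < C * γ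
    product-bound {u} {v} {C} {γ} 0<C u≤C v<γ = begin-strict
      ∣ u * v ∣      ≡⟨ ∣p*q∣≡∣p∣*∣q∣ u v ⟩
      ∣ u ∣ * ∣ v ∣  ≤⟨ *-monoʳ-≤-nonNeg ∣ v ∣ {{∣-∣-nonNeg v}} u≤C ⟩
      C * ∣ v ∣      <⟨ *-monoʳ-<-pos C {{positive 0<C}} v<γ ⟩
      C * γ          ∎
      where open ≤-Reasoning
    bound : ∀ A B K L α β P Q → 0ℚ < A → 0ℚ < B →
      (∀ n → K ℕ.≤ n → ∣ x n ∣ ≤ A) → (∀ n → L ℕ.≤ n → ∣ y n ∣ ≤ B) →
      A * α ≡ ½ * ε → B * β ≡ ½ * ε →
      (∀ m n → P ℕ.≤ m → P ℕ.≤ n → ∣ y m - y n ∣ < α) →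
      (∀ m n → Q ℕ.≤ m → Q ℕ.≤ n → ∣ x m - x n ∣ < β) →
      ∀ m n → (K ℕ.⊔ L) ℕ.⊔ (P ℕ.⊔ Q) ℕ.≤ m → (K ℕ.⊔ L) ℕ.⊔ (P ℕ.⊔ Q) ℕ.≤ n →
      ∣ x m * y m - x n * y n ∣ < ε
    bound A B K L α β P Q 0<A 0<B x≤A y≤B Aα≡½ε Bβ≡½ε y-close x-close m n N≤m N≤n = begin-strict
      ∣ x m * y m - x n * y n ∣
        ≡⟨ cong ∣_∣ (rearrange (x m) (x n) (y m) (y n)) ⟩
      ∣ x m * (y m - y n) + y n * (x m - x n) ∣
        ≤⟨ ∣p+q∣≤∣p∣+∣q∣ (x m * (y m - y n)) (y n * (x m - x n)) ⟩
      ∣ x m * (y m - y n) ∣ + ∣ y n * (x m - x n) ∣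
        <⟨ +-mono-<
             (product-bound {x m} {y m - y n} {A} {α} 0<A (x≤A m (ℕ.m⊔n≤o⇒m≤o K L (KL N≤m)))
               (y-close m n (ℕ.m⊔n≤o⇒m≤o P Q (PQ N≤m)) (ℕ.m⊔n≤o⇒m≤o P Q (PQ N≤n))))
             (product-bound {y n} {x m - x n} {B} {β} 0<B (y≤B n (ℕ.m⊔n≤o⇒n≤o K L (KL N≤n)))
               (x-close m n (ℕ.m⊔n≤o⇒n≤o P Q (PQ N≤m)) (ℕ.m⊔n≤o⇒n≤o P Q (PQ N≤n)))) ⟩
      A * α + B * β
        ≡⟨ cong₂ _+_ Aα≡½ε Bβ≡½ε ⟩
      ½ * ε + ½ * ε
        ≡⟨ ½+½ ε ⟩
      ε ∎
      where
      open ≤-Reasoning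
      KL : ∀ {k} → (K ℕ.⊔ L) ℕ.⊔ (P ℕ.⊔ Q) ℕ.≤ k → K ℕ.⊔ L ℕ.≤ k
      KL = ℕ.m⊔n≤o⇒m≤o (K ℕ.⊔ L) (P ℕ.⊔ Q)
      PQ : ∀ {k} → (K ℕ.⊔ L) ℕ.⊔ (P ℕ.⊔ Q) ℕ.≤ k → P ℕ.⊔ Q ℕ.≤ k
      PQ = ℕ.m⊔n≤o⇒n≤o (K ℕ.⊔ L) (P ℕ.⊔ Q)

open CauchyLemmas

fromℚ : ℚ → ℝ
fromℚ q = mkℝ (λ _ → q) (const-isCauchy q)

0ℝ 1ℝ : ℝ
0ℝ = fromℚ 0ℚ
1ℝ = fromℚ 1ℚ

infixl 6 _+ℝ_
infixl 7 _*ℝ_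

_+ℝ_ : ℝ → ℝ → ℝ
x +ℝ y = mkℝ (λ n → seq x n + seq y n) (+-isCauchy {seq x} {seq y} (isCauchy x) (isCauchy y))

_*ℝ_ : ℝ → ℝ → ℝ
x *ℝ y = mkℝ (λ n → seq x n * seq y n) (*-isCauchy {seq x} {seq y} (isCauchy x) (isCauchy y))

ℝ-rawSemiring : RawSemiring 0ℓ 0ℓ
ℝ-rawSemiring = record
  { Carrier = ℝ ; _≈_ = _≈ℝ_ ; _+_ = _+ℝ_ ; _*_ = _*ℝ_ ; 0# = 0ℝ ; 1# = 1ℝ }

-- k · x is the k-fold sum of x, and x ^ k the k-fold product.
open import Algebra.Definitions.RawSemiring ℝ-rawSemiring public
  using (_^_) renaming (_×_ to infixr 7 _·_)

module ReciprocalLemmas where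
  ⊔-nonZero : ∀ {δ} → 0ℚ < δ → ∀ q → ℚNonZero (q ⊔ δ)
  ⊔-nonZero {δ} 0<δ q =
    pos⇒nonZero (q ⊔ δ) {{positive (<-≤-trans 0<δ (p≤q⊔p q δ))}}

  recip : ∀ {δ} → 0ℚ < δ → ℚ → ℚ
  recip {δ} 0<δ q = (1/ (q ⊔ δ)) {{⊔-nonZero 0<δ q}}

  recip-isCauchy : ∀ {x δ N} → IsCauchy x → (0<δ : 0ℚ < δ) →
    (∀ n → N ℕ.≤ n → δ ≤ x n) → IsCauchy (λ n → recip 0<δ (x n))
  recip-isCauchy {x} {δ} {N} cx 0<δ δ≤x ε 0<ε =
    N ℕ.⊔ M , bound
    where
    close-enough = cx (ε * (δ * δ)) (*-pos 0<ε (*-pos 0<δ 0<δ))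
    M = proj₁ close-enough
    close = proj₂ close-enough
    rearrange : ∀ u v a b → (a - b) * (u * v) ≡ (u * a) * v - (v * b) * u
    rearrange = solve 4 (λ u v a b →
      (a :- b) :* (u :* v) := (u :* a) :* v :- (v :* b) :* u) refl
      where open +-*-Solver
    bound : ∀ m n → N ℕ.⊔ M ℕ.≤ m → N ℕ.⊔ M ℕ.≤ n →
            ∣ recip 0<δ (x m) - recip 0<δ (x n) ∣ < ε
    bound m n N≤m N≤n = *-cancelʳ-<-nonNeg (u * v) {{pos⇒nonNeg (u * v) {{positive 0<uv}}}}
      (begin-strict
      ∣ a - b ∣ * (u * v)        ≡⟨ cong (∣ a - b ∣ *_) (0≤p⇒∣p∣≡p (<⇒≤ 0<uv)) ⟨
      ∣ a - b ∣ * ∣ u * v ∣      ≡⟨ ∣p*q∣≡∣p∣*∣q∣ (a - b) (u * v) ⟨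
      ∣ (a - b) * (u * v) ∣      ≡⟨ cong ∣_∣ (rearrange u v a b) ⟩
      ∣ (u * a) * v - (v * b) * u ∣
        ≡⟨ cong₂ (λ r s → ∣ r * v - s * u ∣)
             (*-inverseʳ u {{⊔-nonZero 0<δ (x m)}}) (*-inverseʳ v {{⊔-nonZero 0<δ (x n)}}) ⟩
      ∣ 1ℚ * v - 1ℚ * u ∣        ≡⟨ cong₂ (λ r s → ∣ r - s ∣) (*-identityˡ v) (*-identityˡ u) ⟩
      ∣ v - u ∣                  ≡⟨ cong₂ (λ r s → ∣ r - s ∣) v≡ u≡ ⟩
      ∣ x n - x m ∣              <⟨ close n m (ℕ.m⊔n≤o⇒n≤o N M N≤n) (ℕ.m⊔n≤o⇒n≤o N M N≤m) ⟩
      ε * (δ * δ)                ≤⟨ *-monoˡ-≤-nonNeg ε {{nonNegative (<⇒≤ 0<ε)}} δδ≤uv ⟩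
      ε * (u * v)                ∎)
      where
      open ≤-Reasoning
      u = x m ⊔ δ
      v = x n ⊔ δ
      a = recip 0<δ (x m)
      b = recip 0<δ (x n)
      δ≤u : δ ≤ u
      δ≤u = p≤q⊔p (x m) δ
      δ≤v : δ ≤ v
      δ≤v = p≤q⊔p (x n) δ
      0<uv : 0ℚ < u * v
      0<uv = *-pos (<-≤-trans 0<δ δ≤u) (<-≤-trans 0<δ δ≤v)
      δδ≤uv : δ * δ ≤ u * v
      δδ≤uv = ≤-trans
        (*-monoʳ-≤-nonNeg δ {{nonNegative (<⇒≤ 0<δ)}} δ≤u)
        (*-monoˡ-≤-nonNeg u {{nonNegative (≤-trans (<⇒≤ 0<δ) δ≤u)}} δ≤v)
      u≡ : u ≡ x m
      u≡ = p≥q⇒p⊔q≡p (δ≤x m (ℕ.m⊔n≤o⇒m≤o N M N≤m))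
      v≡ : v ≡ x n
      v≡ = p≥q⇒p⊔q≡p (δ≤x n (ℕ.m⊔n≤o⇒m≤o N M N≤n))

open ReciprocalLemmas

-- The proof of positivity supplies δ > 0 with δ ≤ seq x n for all large n.
-- The maximum with δ therefore only changes finitely many terms, and makes
-- every term invertible.
reciprocal : (x : ℝ) → 0ℝ <ℝ x → ℝ
reciprocal x (δ , 0<δ , N , δ≤x) = mkℝ
  (λ n → recip 0<δ (seq x n))
  (recip-isCauchy {seq x} (isCauchy x) 0<δ
    (λ n N≤n → subst (_≤ seq x n) (+-identityˡ δ) (δ≤x n N≤n)))

------------------------------------------------------------------------
-- Euler's number, as the sum of the series Σ 1/k!

1/_! : ℕ → ℚ
1/ k ! = (+ 1 / (k !)) {{k ℕ.!≢0}}

e-partialSum : ℕ → ℚ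
e-partialSum zero    = 1/ 0 !
e-partialSum (suc n) = e-partialSum n + 1/ suc n !

module SeriesLemmas where
  1/suc : ℕ → ℚ
  1/suc n = + 1 / suc n

  0<1/ : ∀ k .{{_ : NonZero k}} → 0ℚ < + 1 / k
  0<1/ k = positive⁻¹ (+ 1 / k) {{normalize-pos 1 k}}

  toℚᵘ-1/ : ∀ k .{{_ : NonZero k}} → toℚᵘ (+ 1 / k) ℚᵘ.≃ (+ 1) ℚᵘ./ k
  toℚᵘ-1/ (suc k) = toℚᵘ-fromℚᵘ (ℚᵘ.mkℚᵘ (+ 1) k)

  telescopeᵘ : ∀ n F → suc n ℕ.≤ F → .{{_ : NonZero (suc (suc n) ℕ.* F)}} →
    ((+ 1) ℚᵘ./ (suc (suc n) ℕ.* F)) ℚᵘ.+ ((+ 1) ℚᵘ./ suc (suc n)) ℚᵘ.≤ (+ 1) ℚᵘ./ suc n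
  telescopeᵘ n F@(suc _) c≤F = ℚᵘ.*≤* (begin
    ((+ 1) ℤ.* (+ b) ℤ.+ (+ 1) ℤ.* (+ D)) ℤ.* (+ c)
      ≡⟨ cong (ℤ._* (+ c)) (cong₂ ℤ._+_ (ℤ.*-identityˡ (+ b)) (ℤ.*-identityˡ (+ D))) ⟩
    (+ (b ℕ.+ D)) ℤ.* (+ c)         ≡⟨ ℤ.pos-* (b ℕ.+ D) c ⟨
    + ((b ℕ.+ D) ℕ.* c)             ≤⟨ +≤+ nat ⟩
    + (D ℕ.* b)                     ≡⟨ ℤ.*-identityˡ (+ (D ℕ.* b)) ⟨
    (+ 1) ℤ.* (+ (D ℕ.* b))         ∎)
    where
    open ℤ.≤-Reasoning
    b = suc (suc n)
    c = suc n
    D = b ℕ.* F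
    nat : (b ℕ.+ D) ℕ.* c ℕ.≤ D ℕ.* b
    nat = R.begin
      (b ℕ.+ D) ℕ.* c            R.≡⟨ ℕ.*-distribʳ-+ c b D ⟩
      b ℕ.* c ℕ.+ D ℕ.* c        R.≤⟨ ℕ.+-monoˡ-≤ (D ℕ.* c) (ℕ.*-monoʳ-≤ b c≤F) ⟩
      D ℕ.+ D ℕ.* c              R.≡⟨ ℕ.*-suc D c ⟨
      D ℕ.* b                    R.∎
      where module R = ℕ.≤-Reasoning

  telescope : ∀ n → 1/ suc (suc n) ! + 1/suc (suc n) ≤ 1/suc n
  telescope n = toℚᵘ-cancel-≤ (begin
    toℚᵘ (1/ suc (suc n) ! + 1/suc (suc n))
      ≃⟨ toℚᵘ-homo-+ (1/ suc (suc n) !) (1/suc (suc n)) ⟩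
    toℚᵘ (1/ suc (suc n) !) ℚᵘ.+ toℚᵘ (1/suc (suc n))
      ≃⟨ ℚᵘ.+-cong (toℚᵘ-1/ (suc (suc n) !)) (toℚᵘ-1/ (suc (suc n))) ⟩
    (+ 1) ℚᵘ./ (suc (suc n) !) ℚᵘ.+ (+ 1) ℚᵘ./ suc (suc n)
      ≤⟨ telescopeᵘ n (suc n !) (ℕ.m≤m*n (suc n) (n !) {{n ℕ.!≢0}}) ⟩
    (+ 1) ℚᵘ./ suc n
      ≃⟨ toℚᵘ-1/ (suc n) ⟨
    toℚᵘ (1/suc n) ∎)
    where
    open ℚᵘ.≤-Reasoning
    instance
      !≢0 : NonZero (suc (suc n) !)
      !≢0 = suc (suc n) ℕ.!≢0

  e-mono : ∀ {m n} → m ℕ.≤′ n → e-partialSum m ≤ e-partialSum n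
  e-mono ℕ.≤′-refl = ≤-refl
  e-mono {m} (ℕ.≤′-step {n} m≤n) = begin
    e-partialSum m                     ≤⟨ e-mono m≤n ⟩
    e-partialSum n                     ≡⟨ +-identityʳ (e-partialSum n) ⟨
    e-partialSum n + 0ℚ                ≤⟨ +-monoʳ-≤ (e-partialSum n)
      (<⇒≤ (0<1/ (suc n !) {{suc n ℕ.!≢0}})) ⟩
    e-partialSum n + 1/ suc n !        ∎
    where open ≤-Reasoning

  e-upper : ∀ {m n} → m ℕ.≤′ n →
    e-partialSum (suc n) + 1/suc n ≤ e-partialSum (suc m) + 1/suc m
  e-upper ℕ.≤′-refl = ≤-refl
  e-upper {m} (ℕ.≤′-step {n} m≤n) = begin
    (e-partialSum (suc n) + 1/ suc (suc n) !) + 1/suc (suc n)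
      ≡⟨ +-assoc (e-partialSum (suc n)) (1/ suc (suc n) !) (1/suc (suc n)) ⟩
    e-partialSum (suc n) + (1/ suc (suc n) ! + 1/suc (suc n))
      ≤⟨ +-monoʳ-≤ (e-partialSum (suc n)) (telescope n) ⟩
    e-partialSum (suc n) + 1/suc n
      ≤⟨ e-upper m≤n ⟩
    e-partialSum (suc m) + 1/suc m ∎
    where open ≤-Reasoning

  archimedean : ∀ ε → 0ℚ < ε → ∃[ N ] 1/suc N ≤ ε
  archimedean ε@(mkℚ (ℤ.+_ zero) d _) 0<ε = ⊥-elim (<⇒≢ 0<ε (sym (↥p≡0⇒p≡0 ε refl)))
  archimedean ε@(mkℚ ℤ.+[1+ k ] d _) 0<ε = d , toℚᵘ-cancel-≤ (begin
    toℚᵘ (1/suc d)       ≃⟨ toℚᵘ-1/ (suc d) ⟩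
    ℚᵘ.mkℚᵘ (+ 1) d      ≤⟨ ℚᵘ.*≤* (ℤ.*-monoʳ-≤-nonNeg (+ suc d) (+≤+ (s≤s (z≤n {k})))) ⟩
    toℚᵘ ε               ∎)
    where open ℚᵘ.≤-Reasoning
  archimedean ε@(mkℚ (ℤ.-[1+_] k) d _) 0<ε = ⊥-elim (<-asym 0<ε (negative⁻¹ ε))

  e-close : ∀ {m n} → m ℕ.≤ n → ∣ e-partialSum (suc n) - e-partialSum (suc m) ∣ < 1/suc m
  e-close {m} {n} m≤n = begin-strict
    ∣ E n - E m ∣                      ≡⟨ 0≤p⇒∣p∣≡p (p≤q⇒0≤q-p (e-mono (ℕ.≤⇒≤′ (s≤s m≤n)))) ⟩
    E n - E m                          ≡⟨ +-identityʳ (E n - E m) ⟨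
    (E n - E m) + 0ℚ                   <⟨ +-monoʳ-< (E n - E m) (0<1/ (suc n)) ⟩
    (E n - E m) + 1/suc n              ≡⟨ swap (E n) (E m) (1/suc n) ⟩
    (E n + 1/suc n) - E m              ≤⟨ +-monoˡ-≤ (- E m) (e-upper (ℕ.≤⇒≤′ m≤n)) ⟩
    (E m + 1/suc m) - E m              ≡⟨ cancel (E m) (1/suc m) ⟩
    1/suc m                            ∎
    where
    open ≤-Reasoning
    E : ℕ → ℚ
    E k = e-partialSum (suc k)
    swap : ∀ p q r → (p - q) + r ≡ (p + r) - q
    swap = solve 3 (λ p q r → (p :- q) :+ r := (p :+ r) :- q) refl
      where open +-*-Solver
    cancel : ∀ p q → (p + q) - p ≡ q
    cancel = solve 2 (λ p q → (p :+ q) :- p := q) refl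
      where open +-*-Solver

  e-isCauchy : IsCauchy e-partialSum
  e-isCauchy ε 0<ε = suc N , bound
    where
    half = archimedean (½ * ε) (½*-pos 0<ε)
    N = proj₁ half
    near : ∀ m → suc N ℕ.≤ m → ∣ e-partialSum m - e-partialSum (suc N) ∣ < ½ * ε
    near (suc m) (s≤s N≤m) = <-≤-trans (e-close N≤m) (proj₂ half)
    split : ∀ p q r → p - q ≡ (p - r) + (r - q)
    split = solve 3 (λ p q r → p :- q := (p :- r) :+ (r :- q)) refl
      where open +-*-Solver
    bound : ∀ m n → suc N ℕ.≤ m → suc N ℕ.≤ n → ∣ e-partialSum m - e-partialSum n ∣ < ε
    bound m n N≤m N≤n = begin-strict
      ∣ a - b ∣              ≡⟨ cong ∣_∣ (split a b c) ⟩
      ∣ (a - c) + (c - b) ∣  ≤⟨ ∣p+q∣≤∣p∣+∣q∣ (a - c) (c - b) ⟩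
      ∣ a - c ∣ + ∣ c - b ∣  ≡⟨ cong (_+_ ∣ a - c ∣) (∣-∣-comm c b) ⟩
      ∣ a - c ∣ + ∣ b - c ∣  <⟨ +-mono-< (near m N≤m) (near n N≤n) ⟩
      ½ * ε + ½ * ε          ≡⟨ ½+½ ε ⟩
      ε                      ∎
      where
      open ≤-Reasoning
      a = e-partialSum m
      b = e-partialSum n
      c = e-partialSum (suc N)

open SeriesLemmas

e : ℝ
e = mkℝ e-partialSum e-isCauchy

0<e : 0ℝ <ℝ e
0<e = 1ℚ , positive⁻¹ 1ℚ , 0 , λ n _ →
  subst (_≤ e-partialSum n) (sym (+-identityˡ 1ℚ)) (e-mono (ℕ.≤⇒≤′ (z≤n {n})))

e⁻¹ : ℝ
e⁻¹ = reciprocal e 0<e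

------------------------------------------------------------------------
-- Graphs

record Graph (n : ℕ) : Set₁ where
  field
    Adj    : Rel (Fin n) 0ℓ
    adj?   : Decidable Adj
    symm   : Symmetric Adj
    irrefl : Irreflexive _≡_ Adj

module _ {n : ℕ} (G : Graph n) where
  open Graph G

  Connected : Set
  Connected = ∀ u v → Star Adj u v

  degree : Fin n → ℕ
  degree u = length (filter (adj? u) (allFin n))

  pendantCount : ℕ
  pendantCount = length (filter (λ u → degree u ℕ.≟ 1) (allFin n))

  -- Each edge uv is listed once, as the pair with u < v.
  edges : List (Fin n × Fin n)
  edges = filter (λ (u , v) → u Fin.<? v ×-dec adj? u v) (cartesianProduct (allFin n) (allFin n))

  -- The cycle start, vs₁, …, vsₖ, start, with k ≥ 2.
  record Cycle : Set where
    field
      start    : Fin n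
      vs       : List (Fin n)
      long     : 2 ℕ.≤ length vs
      distinct : Unique (start ∷ vs)
      closed   : Linked Adj (start ∷ vs ∷ʳ start)

    steps : List (Fin n × Fin n)
    steps = zip (start ∷ vs) (vs ∷ʳ start)

    _∼_ : Rel (Fin n) 0ℓ
    u ∼ v = (u , v) ∈ steps ⊎ (v , u) ∈ steps

  -- A Cycle carries a starting vertex and a direction; as subgraphs, two
  -- cycles are the same when they have the same edges.
  SameCycle : Rel Cycle 0ℓ
  SameCycle C D = ∀ u v → Cycle._∼_ C u v ⇔ Cycle._∼_ D u v

  record Unicyclic : Set where
    field
      connected : Connected
      cycle     : Cycle
      unique    : ∀ D → SameCycle D cycle

SEI : ∀ {n} → ℝ → Graph n → ℝ
SEI a G = foldr _+ℝ_ 0ℝ (map (λ (u , v) → a ^ degree G u +ℝ a ^ degree G v) (edges G))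

------------------------------------------------------------------------

n∸p-nonZero : ∀ {n p} → 4 ℕ.≤ n → p ℕ.≤ n ℕ.∸ 3 → NonZero (n ℕ.∸ p)
n∸p-nonZero {n} 4≤n p≤n∸3 = ℕ.>-nonZero (ℕ.m<n⇒0<n∸m
  (ℕ.≤-<-trans p≤n∸3 (ℕ.∸-monoʳ-< {n} (s≤s (z≤n {2})) (ℕ.≤-trans (ℕ.n≤1+n 3) 4≤n))))

{-# OPTIONS --safe #-}
module Submission where

-- Deleting an edge of the cycle of a unicyclic graph leaves a spanning tree, so the graph has n
-- edges and its degrees sum to 2n.  The n − p vertices that are not pendant then have degrees
-- d ≥ 2 whose excesses d − 2 sum to p.  For q ≥ 1 and for 0 ≤ q ≤ ½ the function d ↦ d qᵈ is convex
-- on d ≥ 2; hence its sum lies above the supporting line at m and, by superadditivity in the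
-- excesses, is largest when a single vertex takes the whole excess.  Attaching p pendant vertices
-- to a cycle of length n − p, either evenly or all at one vertex, attains the two bounds.  Everything
-- is done for the rational terms of the sequence a, which are eventually in one of the two ranges.

open import Algebra.Bundles using (CommutativeMonoid; CommutativeRing)
open import Data.Bool.Base using (true; false; if_then_else_)
open import Data.Empty using (⊥; ⊥-elim)
open import Data.Fin.Base as Fin
  using (Fin; zero; suc; fromℕ; inject₁; _↑ˡ_; _↑ʳ_; splitAt; join)
open import Data.Fin.Induction using (<-weakInduction; >-weakInduction)
import Data.Fin.Properties as Fin
open import Data.Fin.Relation.Unary.Top using (view; ‵fromℕ; ‵inject₁)
import Data.Integer.Base as ℤ
open import Data.List.Base
  using (List; []; _∷_; _∷ʳ_; _++_; allFin; cartesianProduct; filter; foldr; length; map; tabulate; zip)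
open import Data.List.Membership.Propositional using (_∈_; _∉_; lose)
open import Data.List.Membership.Propositional.Properties
  using (∈-allFin; ∈-filter⁺; ∈-filter⁻; ∈-cartesianProduct⁺; ∈-∃++; ∈-++⁻)
open import Data.List.Properties using (filter-some; length-tabulate; map-tabulate)
open import Data.List.Relation.Binary.Permutation.Propositional using (_↭_; ↭-sym; ↭⇒↭ₛ)
open import Data.List.Relation.Binary.Permutation.Propositional.Properties
  using (shift; ∈-resp-↭; ↭-length)
import Data.List.Relation.Binary.Permutation.Setoid.Properties as Permutation
open import Data.List.Relation.Unary.All as All using (All; []; _∷_)
import Data.List.Relation.Unary.All.Properties as All
open import Data.List.Relation.Unary.AllPairs using ([]; _∷_; head; tail)
open import Data.List.Relation.Unary.Any using (here; there; any?)
open import Data.List.Relation.Unary.Linked as Linked using (Linked; [-]; _∷_)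
open import Data.List.Relation.Unary.Unique.Propositional using (Unique)
import Data.List.Relation.Unary.Unique.Propositional.Properties as Unique
open import Data.Nat.Base as ℕ using (ℕ; zero; suc; _+_; _*_; _∸_; _≤_; _/_; _%_)
open import Data.Nat.Divisibility using (divides-refl)
import Data.Nat.DivMod as ℕ
import Data.Nat.Properties as ℕ
open import Data.Nat.Solver using () renaming (module +-*-Solver to ℕ-Solver)
open import Data.Product.Base using (∃-syntax; ∃₂; _×_; _,_; proj₁; proj₂)
open import Data.Rational.Base as ℚ using (ℚ; 0ℚ; 1ℚ; ½)
import Data.Rational.Properties as ℚ
open import Data.Rational.Solver using (module +-*-Solver)
open import Data.Sum.Base as Sum using (_⊎_; inj₁; inj₂; [_,_]′; swap)
open import Function.Base using (_∘_; const; id)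
open import Function.Bundles using (mk⇔; Equivalence)
open import Level using (Level; 0ℓ)
open import Relation.Binary.Construct.Closure.ReflexiveTransitive as Star
  using (Star; _◅_; _◅◅_)
open import Relation.Binary.Core using (Rel)
open import Relation.Binary.Definitions using (DecidableEquality; tri<; tri≈; tri>)
open import Relation.Binary.PropositionalEquality
  using (_≡_; _≢_; refl; sym; trans; cong; cong₂; subst; subst₂; module ≡-Reasoning)
  renaming (setoid to ≡-setoid)
open import Relation.Nullary using (Dec; does; yes; no; ¬_; contradiction)
open import Relation.Nullary.Decidable using (_×-dec_; _⊎-dec_)
open import Relation.Unary using (Decidable)

open import Algebra.Definitions.RawSemiring ℚ.+-*-rawSemiring using () renaming (_^_ to _^ℚ_)
open import Defs
open CauchyLemmas using (p≤q⇒0≤q-p)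
open ReciprocalLemmas using (recip; ⊔-nonZero)
open SeriesLemmas using (e-mono)

-- The bound `e⁻¹` is where the second derivative of `x aˣ`, namely `aˣ ln a (2 + x ln a)`, becomes
-- nonnegative for all `x ≥ 2`. Degrees are integers, and the successive differences of `d qᵈ`
-- already increase from `d = 2` on when `q ≤ ½`. This gap is what allows the argument to be run on
-- rational terms: at `a = e⁻¹` the terms of the sequence may lie above `e⁻¹`, but they eventually
-- lie below `½`. The pendant vertices have to be split off because convexity fails at `d = 1`: the
-- second difference there is `q (q − 1) (3 q − 1)`, which is negative for `1/3 < q < 1`, a range
-- that contains `e⁻¹`. Inequalities are needed only for large indices, whereas on the extremal
-- graphs the index and the bound are the same polynomial in `q`, so there the sequences agree term
-- by term.

-- Finite sums in a commutative monoid, and the weighted handshake lemma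

module Summation {c ℓ : Level} (M : CommutativeMonoid c ℓ) where
  open CommutativeMonoid M renaming (refl to ≈-refl; sym to ≈-sym; trans to ≈-trans)
  open import Algebra.Definitions.RawMonoid rawMonoid public using () renaming (_×_ to _⊗_)
  open import Relation.Binary.Reasoning.Setoid setoid
  open import Algebra.Properties.CommutativeSemigroup commutativeSemigroup using (interchange)

  infixr 8 _when_
  _when_ : {P : Set} → Carrier → Dec P → Carrier
  x when d = if does d then x else ε

  ∑ : {A : Set} → List A → (A → Carrier) → Carrier
  ∑ xs h = foldr _∙_ ε (map h xs)

  ∑-cong : {A : Set} (xs : List A) {g h : A → Carrier} → (∀ x → g x ≈ h x) → ∑ xs g ≈ ∑ xs h
  ∑-cong []       g≈h = ≈-refl
  ∑-cong (x ∷ xs) g≈h = ∙-cong (g≈h x) (∑-cong xs g≈h)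

  ∑-ε : {A : Set} (xs : List A) → ∑ xs (const ε) ≈ ε
  ∑-ε []       = ≈-refl
  ∑-ε (x ∷ xs) = ≈-trans (identityˡ _) (∑-ε xs)

  ∑-const : {A : Set} (xs : List A) (y : Carrier) → ∑ xs (const y) ≈ length xs ⊗ y
  ∑-const []       y = ≈-refl
  ∑-const (x ∷ xs) y = ∙-congˡ (∑-const xs y)

  ∑-∙ : {A : Set} (xs : List A) (g h : A → Carrier) →
        ∑ xs (λ x → g x ∙ h x) ≈ ∑ xs g ∙ ∑ xs h
  ∑-∙ []       g h = ≈-sym (identityˡ ε)
  ∑-∙ (x ∷ xs) g h = ≈-trans (∙-congˡ (∑-∙ xs g h)) (interchange (g x) (h x) (∑ xs g) (∑ xs h))

  ∑-++ : {A : Set} (xs ys : List A) (h : A → Carrier) → ∑ (xs ++ ys) h ≈ ∑ xs h ∙ ∑ ys h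
  ∑-++ []       ys h = ≈-sym (identityˡ _)
  ∑-++ (x ∷ xs) ys h = ≈-trans (∙-congˡ (∑-++ xs ys h)) (≈-sym (assoc (h x) (∑ xs h) (∑ ys h)))

  ∑-map : {A B : Set} (f : A → B) (xs : List A) (h : B → Carrier) → ∑ (map f xs) h ≈ ∑ xs (h ∘ f)
  ∑-map f []       h = ≈-refl
  ∑-map f (x ∷ xs) h = ∙-congˡ (∑-map f xs h)

  ∑-comm : {A B : Set} (xs : List A) (ys : List B) (h : A → B → Carrier) →
           ∑ xs (λ x → ∑ ys (h x)) ≈ ∑ ys (λ y → ∑ xs (λ x → h x y))
  ∑-comm []       ys h = ≈-sym (∑-ε ys)
  ∑-comm (x ∷ xs) ys h = ≈-trans (∙-congˡ (∑-comm xs ys h)) (≈-sym (∑-∙ ys (h x) _))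

  ∑-filter : {A : Set} {P : A → Set} (P? : Decidable P) (xs : List A) (h : A → Carrier) →
             ∑ (filter P? xs) h ≈ ∑ xs (λ x → h x when P? x)
  ∑-filter P? []       h = ≈-refl
  ∑-filter P? (x ∷ xs) h with does (P? x)
  ... | true  = ∙-congˡ (∑-filter P? xs h)
  ... | false = ≈-trans (∑-filter P? xs h) (≈-sym (identityˡ _))

  ∑-cartesianProduct : {A B : Set} (xs : List A) (ys : List B) (h : A × B → Carrier) →
    ∑ (cartesianProduct xs ys) h ≈ ∑ xs (λ x → ∑ ys (λ y → h (x , y)))
  ∑-cartesianProduct []       ys h = ≈-refl
  ∑-cartesianProduct (x ∷ xs) ys h = ≈-trans
    (∑-++ (map (x ,_) ys) _ h) (∙-cong (∑-map (x ,_) ys h) (∑-cartesianProduct xs ys h))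

  when-∙ : {P : Set} (d : Dec P) (x y : Carrier) → (x ∙ y) when d ≈ x when d ∙ y when d
  when-∙ d x y with does d
  ... | true  = ≈-refl
  ... | false = ≈-sym (identityˡ ε)

  -- In its use `P` and `Q` are the two strict orders of a pair of vertices, and `R` and `S`
  -- adjacency in the two directions. Exactly one order holds for adjacent vertices, so exactly one
  -- summand survives.
  when-split : {P Q R S : Set} (x : Carrier) (p? : Dec P) (q? : Dec Q) (r? : Dec R) (s? : Dec S) →
    (P → ¬ Q) → (R → S) → (S → R) → (R → P ⊎ Q) →
    x when (p? ×-dec r?) ∙ x when (q? ×-dec s?) ≈ x when r?
  when-split x (yes p) (yes q) _ _ p⇒¬q _ _ _                 = contradiction q (p⇒¬q p)
  when-split x _       _       (yes r) (no ¬s) _ r⇒s _ _      = contradiction (r⇒s r) ¬s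
  when-split x _       _       (no ¬r) (yes s) _ _ s⇒r _      = contradiction (s⇒r s) ¬r
  when-split x (yes p) (no _)  (yes _) (yes _) _ _ _ _        = identityʳ x
  when-split x (no _)  (yes q) (yes _) (yes _) _ _ _ _        = identityˡ x
  when-split x (no ¬p) (no ¬q) (yes r) (yes _) _ _ _ r⇒p⊎q    =
    contradiction r ([ (λ p _ → ¬p p) , (λ q _ → ¬q q) ]′ (r⇒p⊎q r))
  when-split x (yes _) (no _)  (no _)  (no _) _ _ _ _         = identityˡ ε
  when-split x (no _)  (yes _) (no _)  (no _) _ _ _ _         = identityˡ ε
  when-split x (no _)  (no _)  (no _)  (no _) _ _ _ _         = identityˡ ε

  when-cong : {P Q : Set} (x : Carrier) (p? : Dec P) (q? : Dec Q) →
              (P → Q) → (Q → P) → x when p? ≈ x when q?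
  when-cong x (yes _) (yes _) _ _   = ≈-refl
  when-cong x (no _)  (no _)  _ _   = ≈-refl
  when-cong x (yes p) (no ¬q) p⇒q _ = contradiction (p⇒q p) ¬q
  when-cong x (no ¬p) (yes q) _ q⇒p = contradiction (q⇒p q) ¬p

  when-yes : {P : Set} (x : Carrier) (p? : Dec P) → P → x when p? ≈ x
  when-yes x p? p = when-cong x p? (yes p) id id

  when-no : {P : Set} (x : Carrier) (p? : Dec P) → ¬ P → x when p? ≈ ε
  when-no x p? ¬p = when-cong x p? (no ¬p) id id

  ∑-allFin-suc : ∀ n (h : Fin (suc n) → Carrier) →
                 ∑ (allFin (suc n)) h ≈ h zero ∙ ∑ (allFin n) (h ∘ suc)
  ∑-allFin-suc n h = ∙-congˡ (reflexive (cong (foldr _∙_ ε)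
    (trans (map-tabulate suc h) (sym (map-tabulate id (h ∘ suc))))))

  ∑-allFin-+ : ∀ m n (h : Fin (m ℕ.+ n) → Carrier) →
    ∑ (allFin (m ℕ.+ n)) h ≈ ∑ (allFin m) (h ∘ (Fin._↑ˡ n)) ∙ ∑ (allFin n) (h ∘ (m Fin.↑ʳ_))
  ∑-allFin-+ zero    n h = ≈-sym (identityˡ _)
  ∑-allFin-+ (suc m) n h = begin
    ∑ (allFin (suc m ℕ.+ n)) h
      ≈⟨ ∑-allFin-suc (m ℕ.+ n) h ⟩
    h zero ∙ ∑ (allFin (m ℕ.+ n)) (h ∘ suc)
      ≈⟨ ∙-congˡ (∑-allFin-+ m n (h ∘ suc)) ⟩
    h zero ∙ (∑ (allFin m) (λ i → h (suc i Fin.↑ˡ n)) ∙ rest)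
      ≈⟨ assoc (h zero) (∑ (allFin m) (λ i → h (suc i Fin.↑ˡ n))) rest ⟨
    (h zero ∙ ∑ (allFin m) (λ i → h (suc i Fin.↑ˡ n))) ∙ rest
      ≈⟨ ∙-congʳ (∑-allFin-suc m (h ∘ (Fin._↑ˡ n))) ⟨
    ∑ (allFin (suc m)) (h ∘ (Fin._↑ˡ n)) ∙ rest ∎
    where rest = ∑ (allFin n) (h ∘ (suc m Fin.↑ʳ_))

  ∑-allFin-≟ : ∀ {n} (x : Carrier) (i : Fin n) → ∑ (allFin n) (λ j → x when (j Fin.≟ i)) ≈ x
  ∑-allFin-≟ {suc n} x zero = begin
    ∑ (allFin (suc n)) (λ j → x when (j Fin.≟ zero)) ≈⟨ ∑-allFin-suc n _ ⟩
    x ∙ ∑ (allFin n) (const ε)                       ≈⟨ ∙-congˡ (∑-ε (allFin n)) ⟩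
    x ∙ ε                                            ≈⟨ identityʳ x ⟩
    x                                                ∎
  ∑-allFin-≟ {suc n} x (suc i) = begin
    ∑ (allFin (suc n)) (λ j → x when (j Fin.≟ suc i)) ≈⟨ ∑-allFin-suc n _ ⟩
    ε ∙ ∑ (allFin n) (λ j → x when (j Fin.≟ i))      ≈⟨ identityˡ _ ⟩
    ∑ (allFin n) (λ j → x when (j Fin.≟ i))          ≈⟨ ∑-allFin-≟ x i ⟩
    x                                                ∎

  module _ {n : ℕ} (G : Graph n) where
    open Graph G

    private
      Edge? : (u v : Fin n) → Dec (u Fin.< v × Adj u v)
      Edge? u v = u Fin.<? v ×-dec adj? u v

    when-orient : ∀ x u v → x when Edge? u v ∙ x when Edge? v u ≈ x when adj? u v
    when-orient x u v = when-split x (u Fin.<? v) (v Fin.<? u) (adj? u v) (adj? v u)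
      Fin.<-asym symm symm oriented
      where
      oriented : Adj u v → u Fin.< v ⊎ v Fin.< u
      oriented uv with Fin.<-cmp u v
      ... | tri< u<v _ _    = inj₁ u<v
      ... | tri≈ _ u≡v _    = contradiction uv (irrefl u≡v)
      ... | tri> _ _ v<u    = inj₂ v<u

    -- Weighted handshake: every edge is listed with one orientation, and its two ends become the
    -- two orientations of an ordered adjacent pair. With `g = 1` in ℕ it gives the degree sum, with
    -- `g u = q ^ degree u` in ℚ the vertex form of the index; this is why the monoid is a
    -- parameter.
    ∑-edges : (g : Fin n → Carrier) →
      ∑ (edges G) (λ (u , v) → g u ∙ g v) ≈ ∑ (allFin n) (λ u → degree G u ⊗ g u)
    ∑-edges g = begin
      ∑ (edges G) (λ (u , v) → g u ∙ g v)
        ≈⟨ ∑-filter (λ (u , v) → Edge? u v) (cartesianProduct V V) _ ⟩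
      ∑ (cartesianProduct V V) (λ (u , v) → (g u ∙ g v) when Edge? u v)
        ≈⟨ ∑-cartesianProduct V V _ ⟩
      ∑∑ (λ u v → (g u ∙ g v) when Edge? u v)
        ≈⟨ ∑∑-cong (λ u v → when-∙ (Edge? u v) (g u) (g v)) ⟩
      ∑∑ (λ u v → g u when Edge? u v ∙ g v when Edge? u v)
        ≈⟨ ∑∑-∙ _ _ ⟩
      ∑∑ (λ u v → g u when Edge? u v) ∙ ∑∑ (λ u v → g v when Edge? u v)
        -- Exchanging the sums renames the ends, so that the second end of an edge is also counted
        -- at `u`.
        ≈⟨ ∙-congˡ (∑-comm V V _) ⟩
      ∑∑ (λ u v → g u when Edge? u v) ∙ ∑∑ (λ u v → g u when Edge? v u)
        ≈⟨ ∑∑-∙ _ _ ⟨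
      ∑∑ (λ u v → g u when Edge? u v ∙ g u when Edge? v u)
        ≈⟨ ∑∑-cong (λ u v → when-orient (g u) u v) ⟩
      ∑∑ (λ u v → g u when adj? u v)
        ≈⟨ ∑-cong V (λ u → ∑-filter (adj? u) V (const (g u))) ⟨
      ∑ V (λ u → ∑ (filter (adj? u) V) (const (g u)))
        ≈⟨ ∑-cong V (λ u → ∑-const (filter (adj? u) V) (g u)) ⟩
      ∑ V (λ u → degree G u ⊗ g u) ∎
      where
      V = allFin n
      ∑∑ : (Fin n → Fin n → Carrier) → Carrier
      ∑∑ h = ∑ V (λ u → ∑ V (h u))
      ∑∑-cong : ∀ {g h} → (∀ u v → g u v ≈ h u v) → ∑∑ g ≈ ∑∑ h
      ∑∑-cong g≈h = ∑-cong V (λ u → ∑-cong V (g≈h u))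
      ∑∑-∙ : ∀ g h → ∑∑ (λ u v → g u v ∙ h u v) ≈ ∑∑ g ∙ ∑∑ h
      ∑∑-∙ g h = ≈-trans (∑-cong V (λ u → ∑-∙ V (g u) (h u)))
                         (∑-∙ V (λ u → ∑ V (g u)) (λ u → ∑ V (h u)))

module ℕ∑ = Summation ℕ.+-0-commutativeMonoid
open ℕ∑ using (∑; ∑-cong; ∑-const; ∑-comm) renaming (_when_ to _whenℕ_)

⊗-ℕ : ∀ k x → k ℕ∑.⊗ x ≡ k ℕ.* x
⊗-ℕ zero    x = refl
⊗-ℕ (suc k) x = cong (x ℕ.+_) (⊗-ℕ k x)

-- Simple paths

module _ {A : Set} where

  -- The end `y` stands first in the uniqueness condition so that, once an edge from `y` to `x` is
  -- added, it is literally the `distinct` field of a cycle that starts at `y`.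
  SimplePath : Rel A 0ℓ → A → A → Set
  SimplePath R x y = ∃[ zs ] Linked R (x ∷ zs ∷ʳ y) × Unique (y ∷ x ∷ zs)

  -- Loop erasure: when a step from `x` is put in front of a simple path that already visits `x`,
  -- only the part from that visit onwards is kept.
  shorten : ∀ {R : Rel A 0ℓ} {x y w} zs → x ∈ w ∷ zs →
            Linked R (w ∷ zs ∷ʳ y) → Unique (y ∷ w ∷ zs) → SimplePath R x y
  shorten zs       (here refl) linked unique = zs , linked , unique
  shorten (z ∷ zs) (there x∈) (_ ∷ linked) ((_ ∷ y∉) ∷ _ ∷ unique) =
    shorten zs x∈ linked (y∉ ∷ unique)

  module _ (_≟_ : DecidableEquality A) where
    simplePath : ∀ {R : Rel A 0ℓ} {x y} → Star R x y → x ≢ y → SimplePath R x y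
    simplePath Star.ε x≢x = contradiction refl x≢x
    simplePath {x = x} {y} (_◅_ {j = w} xRw w⇝y) x≢y with w ≟ y
    ... | yes refl = [] , xRw ∷ [-] , ((x≢y ∘ sym) ∷ []) ∷ [] ∷ []
    ... | no w≢y with simplePath w⇝y w≢y
    ...   | zs , linked , unique@(y∉ ∷ w∷zs-unique) with any? (x ≟_) (w ∷ zs)
    ...     | yes x∈ = shorten zs x∈ linked unique
    ...     | no x∉ = w ∷ zs , xRw ∷ linked
                    , ((x≢y ∘ sym) ∷ y∉) ∷ All.¬Any⇒All¬ (w ∷ zs) x∉ ∷ w∷zs-unique

  zip-linked : ∀ {R : Rel A 0ℓ} {x y z} zs {w} → (x , y) ∈ zip (w ∷ zs) (zs ∷ʳ z) →
               Linked R (w ∷ zs ∷ʳ z) → R x y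
  zip-linked []       (here refl) (r ∷ _) = r
  zip-linked (_ ∷ zs) (here refl) (r ∷ _) = r
  zip-linked (_ ∷ zs) (there xy∈) (_ ∷ linked) = zip-linked zs xy∈ linked

-- Counting the edges of a forest

module _ {n : ℕ} where

  EdgeList : Set
  EdgeList = List (Fin n × Fin n)

  Joined : EdgeList → Rel (Fin n) 0ℓ
  Joined E u v = (u , v) ∈ E ⊎ (v , u) ∈ E

  Joined-∷ : ∀ {xy E u v} → Joined E u v → Joined (xy ∷ E) u v
  Joined-∷ (inj₁ xy∈) = inj₁ (there xy∈)
  Joined-∷ (inj₂ yx∈) = inj₂ (there yx∈)

  -- Acyclicity in incremental form: each edge joins two vertices that the edges after it in the
  -- list leave unconnected, so adding it merges exactly two components.
  data Forest : EdgeList → Set where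
    []  : Forest []
    _∷_ : ∀ {u v E} → ¬ Star (Joined E) u v → Forest E → Forest ((u , v) ∷ E)

  roots : (Fin n → Fin n) → ℕ
  roots label = ∑ (allFin n) (λ w → 1 whenℕ (label w Fin.≟ w))

  -- label w is a representative of the component of w.
  record Components (E : EdgeList) : Set where
    field
      label       : Fin n → Fin n
      idempotent  : ∀ w → label (label w) ≡ label w
      joined      : ∀ {u v} → label u ≡ label v → Star (Joined E) u v
      constant    : ∀ {u v} → (u , v) ∈ E → label u ≡ label v
      roots+edges : roots label ℕ.+ length E ≡ n


module _ {n : ℕ} where

  discrete : Components {n} []
  discrete = record
    { label       = id
    ; idempotent  = λ _ → refl
    ; joined      = λ { refl → Star.ε }
    ; constant    = λ ()
    ; roots+edges = trans (ℕ.+-identityʳ _) (begin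
        roots {n} id                             ≡⟨ ∑-cong (allFin n) (λ w → ℕ∑.when-yes 1 (w Fin.≟ w) refl) ⟩
        ∑ (allFin n) (const 1)                  ≡⟨ ∑-const (allFin n) 1 ⟩
        length (allFin n) ℕ∑.⊗ 1                ≡⟨ ⊗-ℕ (length (allFin n)) 1 ⟩
        length (allFin n) ℕ.* 1                 ≡⟨ ℕ.*-identityʳ _ ⟩
        length (allFin n)                       ≡⟨ length-tabulate id ⟩
        n                                       ∎)
    }
    where open ≡-Reasoning

  module _ {u v : Fin n} {E : EdgeList} (¬u⇝v : ¬ Star (Joined E) u v) (C : Components E) where
    open Components C

    private
      lu = label u
      lv = label v

      lu≢lv : lu ≢ lv
      lu≢lv = ¬u⇝v ∘ joined

      redirect : Fin n → Fin n
      redirect l = if does (l Fin.≟ lu) then lv else l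

      redirect-≡ : ∀ {l} → l ≡ lu → redirect l ≡ lv
      redirect-≡ {l} l≡lu with l Fin.≟ lu
      ... | yes _   = refl
      ... | no l≢lu = contradiction l≡lu l≢lu

      redirect-≢ : ∀ {l} → l ≢ lu → redirect l ≡ l
      redirect-≢ {l} l≢lu with l Fin.≟ lu
      ... | yes l≡lu = contradiction l≡lu l≢lu
      ... | no _     = refl

      label′ : Fin n → Fin n
      label′ w = redirect (label w)

      label′-≡ : ∀ {w} → label w ≡ lu → label′ w ≡ lv
      label′-≡ = redirect-≡

      label′-≢ : ∀ {w} → label w ≢ lu → label′ w ≡ label w
      label′-≢ = redirect-≢

      label′-lv : label′ lv ≡ lv
      label′-lv = trans (label′-≢ (λ eq → lu≢lv (trans (sym eq) (idempotent v)))) (idempotent v)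

      idempotent′ : ∀ w → label′ (label′ w) ≡ label′ w
      idempotent′ w with label w Fin.≟ lu
      ... | yes _ = label′-lv
      ... | no lw≢lu = trans (label′-≢ (λ eq → lw≢lu (trans (sym (idempotent w)) eq))) (idempotent w)

      old : ∀ {x y} → label x ≡ label y → Star (Joined ((u , v) ∷ E)) x y
      old eq = Star.map Joined-∷ (joined eq)

      joined′ : ∀ {x y} → label′ x ≡ label′ y → Star (Joined ((u , v) ∷ E)) x y
      joined′ {x} {y} eq with label x Fin.≟ lu | label y Fin.≟ lu
      ... | yes x≡u | yes y≡u = old (trans x≡u (sym y≡u))
      ... | yes x≡u | no _    = old x≡u ◅◅ inj₁ (here refl) ◅ old eq
      ... | no _    | yes y≡u = old eq ◅◅ inj₂ (here refl) ◅ old (sym y≡u)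
      ... | no _    | no _    = old eq

      constant′ : ∀ {x y} → (x , y) ∈ (u , v) ∷ E → label′ x ≡ label′ y
      constant′ (here refl) = trans (label′-≡ refl) (sym (label′-≢ (lu≢lv ∘ sym)))
      constant′ (there xy∈) = cong redirect (constant xy∈)

      -- Relabelling the component of `u` by `lv` changes the status of one vertex only: `lu` was a
      -- fixed point of the labelling and stops being one. The root lost pays for the edge gained in
      -- `roots+edges`.
      root-split : ∀ w → 1 whenℕ (label w Fin.≟ w) ≡ 1 whenℕ (label′ w Fin.≟ w) ℕ.+ 1 whenℕ (w Fin.≟ lu)
      root-split w with w Fin.≟ lu
      ... | yes refl = trans (ℕ∑.when-yes 1 (label lu Fin.≟ lu) (idempotent u))
        (cong (ℕ._+ 1) (sym (ℕ∑.when-no 1 (label′ lu Fin.≟ lu)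
          (λ eq → lu≢lv (trans (sym eq) (label′-≡ (idempotent u)))))))
      ... | no w≢lu = trans (ℕ∑.when-cong 1 (label w Fin.≟ w) (label′ w Fin.≟ w) to from)
        (sym (ℕ.+-identityʳ _))
        where
        to : label w ≡ w → label′ w ≡ w
        to eq = trans (label′-≢ (λ lw≡lu → w≢lu (trans (sym eq) lw≡lu))) eq
        from : label′ w ≡ w → label w ≡ w
        from eq with label w Fin.≟ lu
        ... | yes lw≡lu = contradiction
          (trans (sym lw≡lu) (trans (cong label (sym eq)) (idempotent v))) lu≢lv
        ... | no _      = eq

      roots-split : roots label ≡ roots label′ ℕ.+ 1
      roots-split = begin
        roots label
          ≡⟨ ∑-cong (allFin n) root-split ⟩
        ∑ (allFin n) (λ w → 1 whenℕ (label′ w Fin.≟ w) ℕ.+ 1 whenℕ (w Fin.≟ lu))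
          ≡⟨ ℕ∑.∑-∙ (allFin n) _ _ ⟩
        roots label′ ℕ.+ ∑ (allFin n) (λ w → 1 whenℕ (w Fin.≟ lu))
          ≡⟨ cong (roots label′ ℕ.+_) (ℕ∑.∑-allFin-≟ 1 lu) ⟩
        roots label′ ℕ.+ 1 ∎
        where open ≡-Reasoning

    merge : Components ((u , v) ∷ E)
    merge = record
      { label       = label′
      ; idempotent  = idempotent′
      ; joined      = joined′
      ; constant    = constant′
      ; roots+edges = trans (sym (ℕ.+-assoc (roots label′) 1 (length E)))
          (trans (cong (ℕ._+ length E) (sym roots-split)) roots+edges)
      }

  components : ∀ {E} → Forest E → Components E
  components []               = discrete
  components (¬u⇝v ∷ forest) = merge ¬u⇝v (components forest)

-- A unicyclic graph has as many edges as vertices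

module _ {n : ℕ} (G : Graph n) where
  open Graph G

  ∈-edges⁻ : ∀ {u v} → (u , v) ∈ edges G → u Fin.< v × Adj u v
  ∈-edges⁻ uv∈ = proj₂ (∈-filter⁻ (λ (u , v) → u Fin.<? v ×-dec adj? u v)
    {xs = cartesianProduct (allFin n) (allFin n)} uv∈)

  ∈-edges⁺ : ∀ {u v} → u Fin.< v → Adj u v → (u , v) ∈ edges G
  ∈-edges⁺ {u} {v} u<v uv = ∈-filter⁺ (λ (u , v) → u Fin.<? v ×-dec adj? u v)
    (∈-cartesianProduct⁺ (∈-allFin u) (∈-allFin v)) (u<v , uv)

  Joined-edges : ∀ {u v} → Adj u v → Joined (edges G) u v
  Joined-edges {u} {v} uv with Fin.<-cmp u v
  ... | tri< u<v _ _  = inj₁ (∈-edges⁺ u<v uv)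
  ... | tri≈ _ refl _ = contradiction uv (irrefl refl)
  ... | tri> _ _ v<u  = inj₂ (∈-edges⁺ v<u (symm uv))

  edges-unique : Unique (edges G)
  edges-unique = Unique.filter⁺ (λ (u , v) → u Fin.<? v ×-dec adj? u v)
    (Unique.cartesianProduct⁺ (Unique.allFin⁺ n) (Unique.allFin⁺ n))

  -- Any path in F between the ends of another edge closes up to a cycle,
  -- which must be the one through s and h.
  forest : (C : Cycle G) → (∀ D → SameCycle G D C) → ∀ {s h} → Cycle._∼_ C s h →
    ∀ F → (∀ {u v} → (u , v) ∈ F → u Fin.< v × Adj u v) → Unique F → ¬ Joined F s h → Forest F
  forest C same s∼h [] _ _ _ = []
  forest C same {s} {h} s∼h ((u , v) ∷ F) F⊆ (uv∉ ∷ unique) ¬sh = acyclic ∷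
    forest C same s∼h F (F⊆ ∘ there) unique (¬sh ∘ Joined-∷)
    where
    u<v : u Fin.< v
    u<v = proj₁ (F⊆ (here refl))
    adj : ∀ {x y} → Joined ((u , v) ∷ F) x y → Adj x y
    adj (inj₁ xy∈) = proj₂ (F⊆ xy∈)
    adj (inj₂ yx∈) = symm (proj₂ (F⊆ yx∈))
    acyclic : ¬ Star (Joined F) u v
    acyclic u⇝v with simplePath Fin._≟_ u⇝v (Fin.<⇒≢ u<v)
    -- A path of a single edge does not close up to a cycle. It would either repeat the edge
    -- `(u , v)` in the list or reverse it, against the orientation `u < v`.
    ... | [] , inj₁ uv∈ ∷ _ , _ = All.All¬⇒¬Any uv∉ uv∈
    ... | [] , inj₂ vu∈ ∷ _ , _ = Fin.<-asym u<v (proj₁ (F⊆ (there vu∈)))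
    ... | z ∷ zs , linked , distinct = ¬sh
      ([ (λ sh∈ → zip-linked (u ∷ z ∷ zs) sh∈ closed)
       , (λ hs∈ → swap (zip-linked (u ∷ z ∷ zs) hs∈ closed)) ]′
       (Equivalence.from (same D s h) s∼h))
      where
      -- The closed walk is kept in the edge list instead of `Adj`: since `D` has the same edges as
      -- `C`, the pair `s`, `h` occurs on it and would then be joined by the list.
      closed : Linked (Joined ((u , v) ∷ F)) (v ∷ u ∷ z ∷ zs ∷ʳ v)
      closed = inj₂ (here refl) ∷ Linked.map Joined-∷ linked
      D : Cycle G
      D = record { start = v ; vs = u ∷ z ∷ zs ; long = ℕ.s≤s (ℕ.s≤s ℕ.z≤n)
                 ; distinct = distinct ; closed = Linked.map adj closed }


  SameEnds : (s h x y : Fin n) → Set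
  SameEnds s h x y = (x ≡ s × y ≡ h) ⊎ (x ≡ h × y ≡ s)

  record EdgeRemoval (s h : Fin n) : Set where
    field
      rest       : EdgeList
      size       : length (edges G) ≡ suc (length rest)
      rest⊆      : ∀ {u v} → (u , v) ∈ rest → u Fin.< v × Adj u v
      unique     : Unique rest
      removed    : ¬ Joined rest s h
      others     : ∀ {x y} → Adj x y → ¬ SameEnds s h x y → Joined rest x y

  removeEdge-< : ∀ {s h} → s Fin.< h → Adj s h → EdgeRemoval s h
  removeEdge-< {s} {h} s<h sh with ∈-∃++ (∈-edges⁺ s<h sh)
  ... | xs , ys , edges≡ = record
    { rest    = xs ++ ys
    ; size    = ↭-length edges↭
    ; rest⊆   = ∈-edges⁻ ∘ ∈-resp-↭ (↭-sym edges↭) ∘ there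
    ; unique  = tail unique
    ; removed = λ { (inj₁ sh∈) → All.All¬⇒¬Any (head unique) sh∈
                  ; (inj₂ hs∈) → Fin.<-asym s<h (proj₁ (∈-edges⁻ (∈-resp-↭ (↭-sym edges↭) (there hs∈)))) }
    ; others  = others
    }
    where
    edges↭ : edges G ↭ (s , h) ∷ xs ++ ys
    edges↭ = subst (_↭ (s , h) ∷ xs ++ ys) (sym edges≡) (shift (s , h) xs ys)
    unique : Unique ((s , h) ∷ xs ++ ys)
    unique = Permutation.Unique-resp-↭ (≡-setoid _) (↭⇒↭ₛ edges↭) edges-unique
    others : ∀ {x y} → Adj x y → ¬ SameEnds s h x y → Joined (xs ++ ys) x y
    others xy ¬same with Joined-edges xy
    ... | inj₁ xy∈ with ∈-resp-↭ edges↭ xy∈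
    ...   | here refl = contradiction (inj₁ (refl , refl)) ¬same
    ...   | there xy∈ = inj₁ xy∈
    others xy ¬same | inj₂ yx∈ with ∈-resp-↭ edges↭ yx∈
    ...   | here refl = contradiction (inj₂ (refl , refl)) ¬same
    ...   | there yx∈ = inj₂ yx∈

  removeEdge : ∀ {s h} → Adj s h → EdgeRemoval s h
  removeEdge {s} {h} sh with Fin.<-cmp s h
  ... | tri< s<h _ _ = removeEdge-< s<h sh
  ... | tri≈ _ s≡h _ = contradiction sh (irrefl s≡h)
  ... | tri> _ _ h<s = record
    { rest = rest ; size = size ; rest⊆ = rest⊆ ; unique = unique
    ; removed = removed ∘ swap
    ; others = λ xy ¬same → others xy (¬same ∘ swap) }
    where open EdgeRemoval (removeEdge-< h<s (symm sh))

  -- After the edge from `s` to `h` is removed, a component labelling of the remaining forest is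
  -- still constant along every edge of `G`, the removed one included. Connectedness leaves a single
  -- root, and `roots+edges` gives `n`.
  unicyclic-size : (C : Cycle G) → (∀ D → SameCycle G D C) → Connected G →
                      length (edges G) ≡ n
  unicyclic-size C@(record { start = s ; vs = h ∷ h₂ ∷ r ; distinct = (s≢h ∷ s≢h₂ ∷ s∉) ∷ (h≢h₂ ∷ h∉) ∷ _
                              ; closed = sh ∷ hh₂ ∷ linked }) same connected = begin
    length (edges G)               ≡⟨ size ⟩
    1 ℕ.+ length rest              ≡⟨ cong (ℕ._+ length rest) (sym one-root) ⟩
    roots label ℕ.+ length rest    ≡⟨ roots+edges ⟩
    n                              ∎
    where
    open ≡-Reasoning
    open EdgeRemoval (removeEdge sh)
    open Components (components (forest C same (inj₁ (here refl)) rest rest⊆ unique removed))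

    label-other : ∀ {x y} → Adj x y → ¬ SameEnds s h x y → label x ≡ label y
    label-other xy ¬same with others xy ¬same
    ... | inj₁ xy∈ = constant xy∈
    ... | inj₂ yx∈ = sym (constant yx∈)

    label-walk : ∀ {x} zs → Linked Adj (x ∷ zs ∷ʳ s) → x ≢ h → All (_≢ h) zs → label x ≡ label s
    label-walk []       (xs ∷ [-]) x≢h [] =
      label-other xs [ (λ (_ , s≡h) → s≢h s≡h) , (λ (x≡h , _) → x≢h x≡h) ]′
    label-walk (z ∷ zs) (xz ∷ linked) x≢h (z≢h ∷ zs≢h) = trans
      (label-other xz [ (λ (_ , z≡h) → z≢h z≡h) , (λ (x≡h , _) → x≢h x≡h) ]′)
      (label-walk zs linked z≢h zs≢h)

    -- The other arc of the cycle runs from `h` over `h₂` back to `s`. Its first edge does not end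
    -- in `s`, and the later ones avoid `h`, so none of them is the removed edge.
    label-sh : label s ≡ label h
    label-sh = sym (trans
      (label-other hh₂ [ (λ (_ , h₂≡h) → h≢h₂ (sym h₂≡h)) , (λ (_ , h₂≡s) → s≢h₂ (sym h₂≡s)) ]′)
      (label-walk r linked (h≢h₂ ∘ sym) (All.map (_∘ sym) h∉)))

    label-adj : ∀ {x y} → Adj x y → label x ≡ label y
    label-adj {x} {y} xy with x Fin.≟ s ×-dec y Fin.≟ h | x Fin.≟ h ×-dec y Fin.≟ s
    ... | yes (refl , refl) | _                 = label-sh
    ... | no _              | yes (refl , refl) = sym label-sh
    ... | no ¬sh            | no ¬hs            = label-other xy [ ¬sh , ¬hs ]′

    label-const : ∀ {x y} → Star Adj x y → label x ≡ label y
    label-const Star.ε          = refl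
    label-const (xz ◅ z⇝y) = trans (label-adj xz) (label-const z⇝y)

    label-s : ∀ w → label w ≡ label s
    label-s w = label-const (connected w s)

    one-root : roots label ≡ 1
    one-root = trans
      (∑-cong (allFin n) (λ w → ℕ∑.when-cong 1 (label w Fin.≟ w) (w Fin.≟ label s)
        (λ lw≡w → trans (sym lw≡w) (label-s w)) (λ w≡ls → trans (label-s w) (sym w≡ls))))
      (ℕ∑.∑-allFin-≟ 1 (label s))
  unicyclic-size record { vs = _ ∷ [] ; long = ℕ.s≤s () }

  ∑-degree : Unicyclic G → ∑ (allFin n) (degree G) ≡ 2 ℕ.* n
  ∑-degree U = begin
    ∑ (allFin n) (degree G)
      ≡⟨ ∑-cong (allFin n) (λ u → trans (⊗-ℕ (degree G u) 1) (ℕ.*-identityʳ _)) ⟨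
    ∑ (allFin n) (λ u → degree G u ℕ∑.⊗ 1)
      ≡⟨ ℕ∑.∑-edges G (const 1) ⟨
    ∑ (edges G) (const 2)
      ≡⟨ ∑-const (edges G) 2 ⟩
    length (edges G) ℕ∑.⊗ 2
      ≡⟨ ⊗-ℕ (length (edges G)) 2 ⟩
    length (edges G) ℕ.* 2
      ≡⟨ cong (ℕ._* 2) (unicyclic-size cycle unique connected) ⟩
    n ℕ.* 2
      ≡⟨ ℕ.*-comm n 2 ⟩
    2 ℕ.* n ∎
    where
    open ≡-Reasoning
    open Unicyclic U

degree≥1 : ∀ {n} → 2 ℕ.≤ n → (G : Graph n) → Connected G → ∀ u → 1 ℕ.≤ degree G u
degree≥1 2≤n G connected u = positive (other 2≤n u)
  where
  open Graph G
  other : ∀ {n} → 2 ℕ.≤ n → (u : Fin n) → ∃[ v ] u ≢ v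
  other (ℕ.s≤s (ℕ.s≤s _)) zero    = suc zero , λ ()
  other (ℕ.s≤s (ℕ.s≤s _)) (suc u) = zero , λ ()
  positive : ∃[ v ] u ≢ v → 1 ℕ.≤ degree G u
  positive (v , u≢v) with connected u v
  ... | Star.ε = contradiction refl u≢v
  ... | uw ◅ _ = filter-some (adj? u) (lose (∈-allFin _) uw)

module ℚ∑ = Summation ℚ.+-0-commutativeMonoid
open ℚ∑ using (_⊗_) renaming (∑ to ∑ℚ)
open import Algebra.Properties.Monoid.Mult ℚ.+-0-monoid using (×-homo-+; ×-assocˡ)
open import Algebra.Properties.CommutativeMonoid.Mult ℚ.+-0-commutativeMonoid using (×-distrib-+)
open import Algebra.Properties.Semiring.Mult
  (CommutativeRing.semiring ℚ.+-*-commutativeRing) using (×-assoc-*)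

-- Convex functions on ℕ

Δ : (ℕ → ℚ) → ℕ → ℚ
Δ g x = g (suc x) ℚ.- g x

Convex : (ℕ → ℚ) → Set
Convex g = ∀ x → Δ g x ℚ.≤ Δ g (suc x)

+-Δ : ∀ g x → g x ℚ.+ Δ g x ≡ g (suc x)
+-Δ g x = solve 2 (λ a b → a :+ (b :- a) := b) refl (g x) (g (suc x))
  where open +-*-Solver

Δ-mono : ∀ g → Convex g → ∀ x k → Δ g x ℚ.≤ Δ g (k ℕ.+ x)
Δ-mono g convex x zero    = ℚ.≤-refl
Δ-mono g convex x (suc k) = ℚ.≤-trans (Δ-mono g convex x k) (convex (k ℕ.+ x))

Δ-mono-≤ : ∀ g → Convex g → ∀ {x y} → x ℕ.≤ y → Δ g x ℚ.≤ Δ g y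
Δ-mono-≤ g convex {x} x≤y = subst (λ z → Δ g x ℚ.≤ Δ g z) (ℕ.m∸n+n≡m x≤y) (Δ-mono g convex x _)

swap-left : ∀ a b c → a ℚ.+ (b ℚ.+ c) ≡ b ℚ.+ (a ℚ.+ c)
swap-left = solve 3 (λ a b c → a :+ (b :+ c) := b :+ (a :+ c)) refl
  where open +-*-Solver

-- Increments at most `c` before `m` and at least `c` from `m` on keep `g` above the line of slope
-- `c` through its value at `m`. The term `(x − m) c` is spread over both sides to avoid signs;
-- shifting `g` lowers `m` and `x` together until one of them is 0.
supporting-line : ∀ g c m x →
  (∀ y → y ℕ.< m → g (suc y) ℚ.≤ g y ℚ.+ c) → (∀ y → m ℕ.≤ y → g y ℚ.+ c ℚ.≤ g (suc y)) →
  g m ℚ.+ x ⊗ c ℚ.≤ g x ℚ.+ m ⊗ c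
supporting-line g c zero zero _ _ = ℚ.≤-refl
supporting-line g c (suc m) (suc x) below above = begin
  g (suc m) ℚ.+ (c ℚ.+ x ⊗ c)  ≡⟨ swap-left (g (suc m)) c (x ⊗ c) ⟩
  c ℚ.+ (g (suc m) ℚ.+ x ⊗ c)  ≤⟨ ℚ.+-monoʳ-≤ c (supporting-line (g ∘ suc) c m x
                                     (λ y y<m → below (suc y) (ℕ.s≤s y<m)) (λ y m≤y → above (suc y) (ℕ.s≤s m≤y))) ⟩
  c ℚ.+ (g (suc x) ℚ.+ m ⊗ c)  ≡⟨ swap-left c (g (suc x)) (m ⊗ c) ⟩
  g (suc x) ℚ.+ (c ℚ.+ m ⊗ c)  ∎
  where open ℚ.≤-Reasoning
supporting-line g c zero (suc x) below above = begin
  g 0 ℚ.+ (c ℚ.+ x ⊗ c)    ≡⟨ ℚ.+-assoc (g 0) c (x ⊗ c) ⟨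
  (g 0 ℚ.+ c) ℚ.+ x ⊗ c    ≤⟨ ℚ.+-monoˡ-≤ (x ⊗ c) (above 0 ℕ.z≤n) ⟩
  g 1 ℚ.+ x ⊗ c            ≤⟨ supporting-line (g ∘ suc) c 0 x (λ _ ()) (λ y _ → above (suc y) ℕ.z≤n) ⟩
  g (suc x) ℚ.+ 0ℚ         ∎
  where open ℚ.≤-Reasoning
supporting-line g c (suc m) zero below above = begin
  g (suc m) ℚ.+ 0ℚ         ≤⟨ supporting-line (g ∘ suc) c m 0
                                (λ y y<m → below (suc y) (ℕ.s≤s y<m)) (λ y m≤y → above (suc y) (ℕ.s≤s m≤y)) ⟩
  g 1 ℚ.+ m ⊗ c            ≤⟨ ℚ.+-monoˡ-≤ (m ⊗ c) (below 0 (ℕ.s≤s ℕ.z≤n)) ⟩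
  (g 0 ℚ.+ c) ℚ.+ m ⊗ c    ≡⟨ ℚ.+-assoc (g 0) c (m ⊗ c) ⟩
  g 0 ℚ.+ (c ℚ.+ m ⊗ c)    ∎
  where open ℚ.≤-Reasoning

convex-supporting-line : ∀ g → Convex g → ∀ m x → g m ℚ.+ x ⊗ Δ g m ℚ.≤ g x ℚ.+ m ⊗ Δ g m
convex-supporting-line g convex m x = supporting-line g (Δ g m) m x
  (λ y y<m → subst (ℚ._≤ g y ℚ.+ Δ g m) (+-Δ g y) (ℚ.+-monoʳ-≤ (g y) (Δ-mono-≤ g convex (ℕ.<⇒≤ y<m))))
  (λ y m≤y → subst (g y ℚ.+ Δ g m ℚ.≤_) (+-Δ g y) (ℚ.+-monoʳ-≤ (g y) (Δ-mono-≤ g convex m≤y)))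

-- With slope `Δ g m` the line passes through two consecutive points of the graph of `g`, so values
-- that are all `m` or `suc m` lose nothing.
supporting-line-≡ : ∀ g m x → x ≡ m ⊎ x ≡ suc m → g m ℚ.+ x ⊗ Δ g m ≡ g x ℚ.+ m ⊗ Δ g m
supporting-line-≡ g m _ (inj₁ refl) = refl
supporting-line-≡ g m _ (inj₂ refl) = trans (sym (ℚ.+-assoc (g m) (Δ g m) (m ⊗ Δ g m)))
                                            (cong (ℚ._+ m ⊗ Δ g m) (+-Δ g m))

-- Moving one unit from the first argument to the second does not lower the sum, as the increment at
-- `x` is at most the one at `x + y`. The term `g 0` is carried along because `weight₂₊` does not
-- vanish at 0 in general.
superadditive : ∀ g → Convex g → ∀ x y → g x ℚ.+ g y ℚ.≤ g 0 ℚ.+ g (x ℕ.+ y)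
superadditive g convex zero    y = ℚ.≤-refl
superadditive g convex (suc x) y = begin
  g (suc x) ℚ.+ g y                           ≡⟨ cong (ℚ._+ g y) (+-Δ g x) ⟨
  (g x ℚ.+ Δ g x) ℚ.+ g y                     ≡⟨ rearrange (g x) (Δ g x) (g y) ⟩
  (g x ℚ.+ g y) ℚ.+ Δ g x                     ≤⟨ ℚ.+-mono-≤ (superadditive g convex x y)
                                                  (Δ-mono-≤ g convex (ℕ.m≤m+n x y)) ⟩
  (g 0 ℚ.+ g (x ℕ.+ y)) ℚ.+ Δ g (x ℕ.+ y)     ≡⟨ ℚ.+-assoc (g 0) (g (x ℕ.+ y)) (Δ g (x ℕ.+ y)) ⟩
  g 0 ℚ.+ (g (x ℕ.+ y) ℚ.+ Δ g (x ℕ.+ y))     ≡⟨ cong (g 0 ℚ.+_) (+-Δ g (x ℕ.+ y)) ⟩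
  g 0 ℚ.+ g (suc x ℕ.+ y)                     ∎
  where
  open ℚ.≤-Reasoning
  rearrange : ∀ a b c → (a ℚ.+ b) ℚ.+ c ≡ (a ℚ.+ c) ℚ.+ b
  rearrange = solve 3 (λ a b c → (a :+ b) :+ c := (a :+ c) :+ b) refl
    where open +-*-Solver

-- Sums of a convex function

balancedSum : (ℕ → ℚ) → (m t N : ℕ) → ℚ
balancedSum g m t N = (N ℕ.∸ t) ⊗ g m ℚ.+ t ⊗ g (suc m)

module _ {A : Set} (x : A → ℕ) where

  ∑-⊗ : ∀ us c → ∑ℚ us (λ u → x u ⊗ c) ≡ ℕ∑.∑ us x ⊗ c
  ∑-⊗ []       c = refl
  ∑-⊗ (u ∷ us) c = trans (cong (x u ⊗ c ℚ.+_) (∑-⊗ us c)) (sym (×-homo-+ c (x u) (ℕ∑.∑ us x)))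

  ∑-mono-≤ : ∀ (us : List A) {g h : A → ℚ} → (∀ u → g u ℚ.≤ h u) → ∑ℚ us g ℚ.≤ ∑ℚ us h
  ∑-mono-≤ []       g≤h = ℚ.≤-refl
  ∑-mono-≤ (u ∷ us) g≤h = ℚ.+-mono-≤ (g≤h u) (∑-mono-≤ us g≤h)

  module _ (g : ℕ → ℚ) (m t : ℕ) (us : List A)
           (t≤ : t ℕ.≤ length us) (∑x : ℕ∑.∑ us x ≡ t ℕ.+ length us ℕ.* m) where
    private
      N = length us
      c = Δ g m

      total = balancedSum g m t N

      -- The supporting lines add up to a number that depends on `x` only through its sum. `values`
      -- adds up the other sides of the same inequalities, and the common `(N * m) ⊗ c` cancels.
      lines : ∑ℚ us (λ u → g m ℚ.+ x u ⊗ c) ≡ total ℚ.+ (N ℕ.* m) ⊗ c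
      lines = begin
        ∑ℚ us (λ u → g m ℚ.+ x u ⊗ c)
          ≡⟨ ℚ∑.∑-∙ us (const (g m)) (λ u → x u ⊗ c) ⟩
        ∑ℚ us (const (g m)) ℚ.+ ∑ℚ us (λ u → x u ⊗ c)
          ≡⟨ cong₂ ℚ._+_ (ℚ∑.∑-const us (g m)) (trans (∑-⊗ us c) (cong (_⊗ c) ∑x)) ⟩
        N ⊗ g m ℚ.+ (t ℕ.+ N ℕ.* m) ⊗ c
          ≡⟨ cong₂ ℚ._+_ (cong (_⊗ g m) (sym (ℕ.m∸n+n≡m t≤))) (×-homo-+ c t (N ℕ.* m)) ⟩
        ((N ℕ.∸ t) ℕ.+ t) ⊗ g m ℚ.+ (t ⊗ c ℚ.+ (N ℕ.* m) ⊗ c)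
          ≡⟨ cong (ℚ._+ (t ⊗ c ℚ.+ (N ℕ.* m) ⊗ c)) (×-homo-+ (g m) (N ℕ.∸ t) t) ⟩
        ((N ℕ.∸ t) ⊗ g m ℚ.+ t ⊗ g m) ℚ.+ (t ⊗ c ℚ.+ (N ℕ.* m) ⊗ c)
          ≡⟨ regroup ((N ℕ.∸ t) ⊗ g m) (t ⊗ g m) (t ⊗ c) ((N ℕ.* m) ⊗ c) ⟩
        ((N ℕ.∸ t) ⊗ g m ℚ.+ (t ⊗ g m ℚ.+ t ⊗ c)) ℚ.+ (N ℕ.* m) ⊗ c
          ≡⟨ cong (λ z → ((N ℕ.∸ t) ⊗ g m ℚ.+ z) ℚ.+ (N ℕ.* m) ⊗ c)
               (trans (sym (×-distrib-+ (g m) c t)) (cong (t ⊗_) (+-Δ g m))) ⟩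
        total ℚ.+ (N ℕ.* m) ⊗ c ∎
        where
        open ≡-Reasoning
        regroup : ∀ a b c d → (a ℚ.+ b) ℚ.+ (c ℚ.+ d) ≡ (a ℚ.+ (b ℚ.+ c)) ℚ.+ d
        regroup = solve 4 (λ a b c d → (a :+ b) :+ (c :+ d) := (a :+ (b :+ c)) :+ d) refl
          where open +-*-Solver

      values : ∑ℚ us (λ u → g (x u) ℚ.+ m ⊗ c) ≡ ∑ℚ us (g ∘ x) ℚ.+ (N ℕ.* m) ⊗ c
      values = trans (ℚ∑.∑-∙ us (g ∘ x) (const (m ⊗ c)))
        (cong (∑ℚ us (g ∘ x) ℚ.+_) (trans (ℚ∑.∑-const us (m ⊗ c)) (×-assocˡ c N m)))

      cancel : ∀ a b → (a ℚ.+ b) ℚ.- b ≡ a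
      cancel = solve 2 (λ a b → (a :+ b) :- b := a) refl
        where open +-*-Solver

    ∑-convex-lower : Convex g → balancedSum g m t (length us) ℚ.≤ ∑ℚ us (g ∘ x)
    ∑-convex-lower convex = begin
      total                                  ≡⟨ cancel total z ⟨
      (total ℚ.+ z) ℚ.- z                    ≡⟨ cong (ℚ._- z) lines ⟨
      ∑ℚ us (λ u → g m ℚ.+ x u ⊗ c) ℚ.- z       ≤⟨ ℚ.+-monoˡ-≤ (ℚ.- z)
                                                   (∑-mono-≤ us (λ u → convex-supporting-line g convex m (x u))) ⟩
      ∑ℚ us (λ u → g (x u) ℚ.+ m ⊗ c) ℚ.- z     ≡⟨ cong (ℚ._- z) values ⟩
      (∑ℚ us (g ∘ x) ℚ.+ z) ℚ.- z               ≡⟨ cancel (∑ℚ us (g ∘ x)) z ⟩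
      ∑ℚ us (g ∘ x)                             ∎
      where
      open ℚ.≤-Reasoning
      z = (N ℕ.* m) ⊗ c

    ∑-balanced : (∀ u → x u ≡ m ⊎ x u ≡ suc m) → ∑ℚ us (g ∘ x) ≡ balancedSum g m t (length us)
    ∑-balanced near = begin
      ∑ℚ us (g ∘ x)                             ≡⟨ cancel (∑ℚ us (g ∘ x)) z ⟨
      (∑ℚ us (g ∘ x) ℚ.+ z) ℚ.- z               ≡⟨ cong (ℚ._- z) values ⟨
      ∑ℚ us (λ u → g (x u) ℚ.+ m ⊗ c) ℚ.- z     ≡⟨ cong (ℚ._- z) (ℚ∑.∑-cong us
                                                     (λ u → supporting-line-≡ g m (x u) (near u))) ⟨
      ∑ℚ us (λ u → g m ℚ.+ x u ⊗ c) ℚ.- z       ≡⟨ cong (ℚ._- z) lines ⟩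
      (total ℚ.+ z) ℚ.- z                    ≡⟨ cancel total z ⟩
      total                                  ∎
      where
      open ≡-Reasoning
      z = (N ℕ.* m) ⊗ c

  -- The values are merged into one by superadditivity, and each merge frees one `g 0`. The extra
  -- `g 0` on the left makes the empty list a valid base case.
  ∑-convex-upper : ∀ g → Convex g → ∀ us →
    g 0 ℚ.+ ∑ℚ us (g ∘ x) ℚ.≤ g (ℕ∑.∑ us x) ℚ.+ length us ⊗ g 0
  ∑-convex-upper g convex []       = ℚ.≤-refl
  ∑-convex-upper g convex (u ∷ us) = begin
    g 0 ℚ.+ (g (x u) ℚ.+ ∑ℚ us (g ∘ x))        ≡⟨ swap-left (g 0) (g (x u)) _ ⟩
    g (x u) ℚ.+ (g 0 ℚ.+ ∑ℚ us (g ∘ x))        ≤⟨ ℚ.+-monoʳ-≤ (g (x u)) (∑-convex-upper g convex us) ⟩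
    g (x u) ℚ.+ (g S ℚ.+ length us ⊗ g 0)      ≡⟨ ℚ.+-assoc (g (x u)) (g S) _ ⟨
    (g (x u) ℚ.+ g S) ℚ.+ length us ⊗ g 0      ≤⟨ ℚ.+-monoˡ-≤ _ (superadditive g convex (x u) S) ⟩
    (g 0 ℚ.+ g (x u ℕ.+ S)) ℚ.+ length us ⊗ g 0 ≡⟨ rearrange (g 0) (g (x u ℕ.+ S)) _ ⟩
    g (x u ℕ.+ S) ℚ.+ (g 0 ℚ.+ length us ⊗ g 0) ∎
    where
    open ℚ.≤-Reasoning
    S = ℕ∑.∑ us x
    rearrange : ∀ a b c → (a ℚ.+ b) ℚ.+ c ≡ b ℚ.+ (a ℚ.+ c)
    rearrange = solve 3 (λ a b c → (a :+ b) :+ c := b :+ (a :+ c)) refl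
      where open +-*-Solver

-- The function d qᵈ

weight : ℚ → ℕ → ℚ
weight q d = d ⊗ q ^ℚ d

-- The number ½ is the exact threshold below 1: at `d = 2` the second difference of `d qᵈ` is
-- `q² (q − 1) (4 q − 2)`.
Admissible : ℚ → Set
Admissible q = 0ℚ ℚ.≤ q × (1ℚ ℚ.≤ q ⊎ q ℚ.≤ ½)

0≤q-p⇒p≤q : ∀ {p q} → 0ℚ ℚ.≤ q ℚ.- p → p ℚ.≤ q
0≤q-p⇒p≤q {p} {q} 0≤q-p = begin
  p               ≡⟨ ℚ.+-identityʳ p ⟨
  p ℚ.+ 0ℚ        ≤⟨ ℚ.+-monoʳ-≤ p 0≤q-p ⟩
  p ℚ.+ (q ℚ.- p) ≡⟨ solve 2 (λ p q → p :+ (q :- p) := q) refl p q ⟩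
  q               ∎
  where
  open ℚ.≤-Reasoning
  open +-*-Solver

0≤+ : ∀ {p q} → 0ℚ ℚ.≤ p → 0ℚ ℚ.≤ q → 0ℚ ℚ.≤ p ℚ.+ q
0≤+ = ℚ.+-mono-≤

0≤* : ∀ {p q} → 0ℚ ℚ.≤ p → 0ℚ ℚ.≤ q → 0ℚ ℚ.≤ p ℚ.* q
0≤* {p} {q} 0≤p 0≤q = subst (ℚ._≤ p ℚ.* q) (ℚ.*-zeroʳ p)
  (ℚ.*-monoˡ-≤-nonNeg p {{ℚ.nonNegative 0≤p}} 0≤q)

0≤⊗1 : ∀ k → 0ℚ ℚ.≤ k ⊗ 1ℚ
0≤⊗1 zero    = ℚ.≤-refl
0≤⊗1 (suc k) = 0≤+ (ℚ.nonNegative⁻¹ 1ℚ) (0≤⊗1 k)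

0≤^ : ∀ {q} → 0ℚ ℚ.≤ q → ∀ k → 0ℚ ℚ.≤ q ^ℚ k
0≤^ 0≤q zero    = ℚ.nonNegative⁻¹ 1ℚ
0≤^ 0≤q (suc k) = 0≤* 0≤q (0≤^ 0≤q k)

-- Turns the multiplicity `d` into a rational factor, which the ring solver can treat as a variable.
weight-⊗1 : ∀ q d → weight q d ≡ d ⊗ 1ℚ ℚ.* q ^ℚ d
weight-⊗1 q d = sym (trans (×-assoc-* d 1ℚ (q ^ℚ d)) (cong (d ⊗_) (ℚ.*-identityˡ (q ^ℚ d))))

2ℚ : ℚ
2ℚ = 1ℚ ℚ.+ 1ℚ

-- The second difference of d qᵈ at d = κ + 2 is q^d (q − 1) ((κ + 4)(q − 1) + 2); for q ≤ ½ both
-- factors after q^d are nonpositive.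
weight-convex : ∀ {q} → Admissible q → Convex (λ x → weight q (2 ℕ.+ x))
weight-convex {q} (0≤q , range) x = 0≤q-p⇒p≤q (subst (0ℚ ℚ.≤_) (sym factored) (positive range))
  where
  κ Y : ℚ
  κ = x ⊗ 1ℚ
  Y = q ^ℚ (2 ℕ.+ x)
  0≤κ : 0ℚ ℚ.≤ κ
  0≤κ = 0≤⊗1 x
  0≤Y : 0ℚ ℚ.≤ Y
  0≤Y = 0≤^ 0≤q (2 ℕ.+ x)

  second : ℚ
  second = Y ℚ.* ((q ℚ.- 1ℚ) ℚ.* ((κ ℚ.+ (2ℚ ℚ.+ 2ℚ)) ℚ.* (q ℚ.- 1ℚ) ℚ.+ 2ℚ))

  factored : Δ (λ x → weight q (2 ℕ.+ x)) (suc x) ℚ.- Δ (λ x → weight q (2 ℕ.+ x)) x ≡ second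
  factored = trans
    (cong₂ ℚ._-_ (cong₂ ℚ._-_ (weight-⊗1 q (4 ℕ.+ x)) (weight-⊗1 q (3 ℕ.+ x)))
                 (cong₂ ℚ._-_ (weight-⊗1 q (3 ℕ.+ x)) (weight-⊗1 q (2 ℕ.+ x))))
    (solve 3 (λ κ q Y → let 1′ = con 1ℚ ; 2′ = 1′ :+ 1′ in
      (((1′ :+ (1′ :+ (1′ :+ (1′ :+ κ)))) :* (q :* (q :* Y)) :- (1′ :+ (1′ :+ (1′ :+ κ))) :* (q :* Y))
       :- ((1′ :+ (1′ :+ (1′ :+ κ))) :* (q :* Y) :- (1′ :+ (1′ :+ κ)) :* Y))
      := Y :* ((q :- 1′) :* ((κ :+ (2′ :+ 2′)) :* (q :- 1′) :+ 2′)))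
      refl κ q Y)
    where open +-*-Solver

  positive : 1ℚ ℚ.≤ q ⊎ q ℚ.≤ ½ → 0ℚ ℚ.≤ second
  positive (inj₁ 1≤q) = 0≤* 0≤Y (0≤* 0≤q-1
    (0≤+ (0≤* (0≤+ 0≤κ (ℚ.nonNegative⁻¹ (2ℚ ℚ.+ 2ℚ))) 0≤q-1) (ℚ.nonNegative⁻¹ 2ℚ)))
    where
    0≤q-1 = p≤q⇒0≤q-p 1≤q
  -- Both nonpositive factors are negated and written through `½ − q`: `1 − q = (½ − q) + ½`, and
  -- `−((κ + 4)(q − 1) + 2) = (κ + 4)(½ − q) + ½ κ`.
  positive (inj₂ q≤½) = subst (0ℚ ℚ.≤_) eq (0≤* 0≤Y (0≤* (0≤+ 0≤½-q (ℚ.nonNegative⁻¹ ½))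
    (0≤+ (0≤* (0≤+ 0≤κ (ℚ.nonNegative⁻¹ (2ℚ ℚ.+ 2ℚ))) 0≤½-q) (0≤* (ℚ.nonNegative⁻¹ ½) 0≤κ))))
    where
    0≤½-q = p≤q⇒0≤q-p q≤½
    eq : Y ℚ.* (((½ ℚ.- q) ℚ.+ ½) ℚ.* ((κ ℚ.+ (2ℚ ℚ.+ 2ℚ)) ℚ.* (½ ℚ.- q) ℚ.+ ½ ℚ.* κ)) ≡ second
    eq = solve 3 (λ κ q Y → let 1′ = con 1ℚ ; 2′ = 1′ :+ 1′ ; h = con ½ in
      Y :* (((h :- q) :+ h) :* ((κ :+ (2′ :+ 2′)) :* (h :- q) :+ h :* κ))
      := Y :* ((q :- 1′) :* ((κ :+ (2′ :+ 2′)) :* (q :- 1′) :+ 2′))) refl κ q Y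
      where open +-*-Solver

-- Vertices of a cycle

module _ {A : Set} where

  ∈-zip : ∀ {x y : A} xs ys → (x , y) ∈ zip xs ys → x ∈ xs × y ∈ ys
  ∈-zip (_ ∷ xs) (_ ∷ ys) (here refl) = here refl , here refl
  ∈-zip (_ ∷ xs) (_ ∷ ys) (there xy∈) with ∈-zip xs ys xy∈
  ... | x∈ , y∈ = there x∈ , there y∈

  zip-last : ∀ w (zs : List A) {z} → ∃[ x ] x ∈ w ∷ zs × (x , z) ∈ zip (w ∷ zs) (zs ∷ʳ z)
  zip-last w []       = w , here refl , here refl
  zip-last w (v ∷ zs) with zip-last v zs
  ... | x , x∈ , xz∈ = x , there x∈ , there xz∈

  -- Predecessor and successor of `u`. The closing vertex `z` belongs to the uniqueness condition
  -- because it is the successor of the last vertex.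
  zip-interior : ∀ {u z} w (zs : List A) → u ∈ zs → Unique (z ∷ w ∷ zs) →
    ∃₂ λ x y → (x , u) ∈ zip (w ∷ zs) (zs ∷ʳ z) × (u , y) ∈ zip (w ∷ zs) (zs ∷ʳ z) × x ≢ y
  zip-interior w (u ∷ []) (here refl) ((z≢w ∷ _) ∷ _) =
    w , _ , here refl , there (here refl) , z≢w ∘ sym
  zip-interior w (u ∷ y ∷ zs) (here refl) (_ ∷ (_ ∷ w≢y ∷ _) ∷ _) =
    w , y , here refl , there (here refl) , w≢y
  zip-interior w (v ∷ zs) (there u∈) ((_ ∷ z∉) ∷ _ ∷ unique)
    with zip-interior v zs u∈ (z∉ ∷ unique)
  ... | x , y , xu∈ , uy∈ , x≢y = x , y , there xu∈ , there uy∈ , x≢y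

module _ {n : ℕ} {G : Graph n} (C : Cycle G) where
  open Graph G
  open Cycle C

  ∼-sym : ∀ {u v} → u ∼ v → v ∼ u
  ∼-sym = swap

  ∼⇒Adj : ∀ {u v} → u ∼ v → Adj u v
  ∼⇒Adj (inj₁ uv∈) = zip-linked vs uv∈ closed
  ∼⇒Adj (inj₂ vu∈) = symm (zip-linked vs vu∈ closed)

  ∼-∈ʳ : ∀ {u v} → u ∼ v → v ∈ start ∷ vs
  ∼-∈ʳ (inj₂ vu∈) = proj₁ (∈-zip (start ∷ vs) (vs ∷ʳ start) vu∈)
  ∼-∈ʳ (inj₁ uv∈) with ∈-++⁻ vs (proj₂ (∈-zip (start ∷ vs) (vs ∷ʳ start) uv∈))
  ... | inj₁ v∈          = there v∈
  ... | inj₂ (here refl) = here refl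

-- This is what pins down the cycles of the extremal graphs: it keeps them away from pendant
-- vertices and forces them to use both ring edges at every vertex they visit. The start is treated
-- separately since its second neighbour is the last vertex of the list.
two-neighbours : ∀ {n} {G : Graph n} (C : Cycle G) → let open Cycle C in ∀ {u} → u ∈ start ∷ vs →
  ∃₂ λ x y → u ∼ x × u ∼ y × x ≢ y
two-neighbours record { vs = v ∷ w ∷ zs ; distinct = _ ∷ (v∉ ∷ _) } (here refl)
  with zip-last w zs
... | x , x∈ , xs∈ = v , x , inj₁ (here refl) , inj₂ (there (there xs∈)) , All.lookup v∉ x∈
two-neighbours record { vs = v ∷ w ∷ zs ; distinct = (_ ∷ s≢w ∷ _) ∷ _ } (there (here refl)) =
  _ , w , inj₂ (here refl) , inj₁ (there (here refl)) , s≢w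
two-neighbours record { vs = v ∷ w ∷ zs ; distinct = distinct } (there (there u∈))
  with zip-interior v (w ∷ zs) u∈ distinct
... | x , y , xu∈ , uy∈ , x≢y = x , y , inj₂ (there xu∈) , inj₁ (there uy∈) , x≢y
two-neighbours record { vs = _ ∷ [] ; long = ℕ.s≤s () } _

-- The cyclic order on Fin (suc k)

module _ {k : ℕ} where

  -- The cyclic step goes downwards, with `zero` sent to the top, so that it is defined by matching
  -- on constructors; only the inverse needs the view of the top element.
  next : Fin (suc k) → Fin (suc k)
  next zero    = fromℕ k
  next (suc i) = inject₁ i

  prev : Fin (suc k) → Fin (suc k)
  prev i with view i
  ... | ‵fromℕ     = zero
  ... | ‵inject₁ j = suc j

  next-prev : ∀ i → next (prev i) ≡ i
  next-prev i with view i
  ... | ‵fromℕ     = refl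
  ... | ‵inject₁ j = refl

  next-injective : ∀ {i j} → next i ≡ next j → i ≡ j
  next-injective {zero}  {zero}  _  = refl
  next-injective {zero}  {suc j} eq = contradiction eq Fin.fromℕ≢inject₁
  next-injective {suc i} {zero}  eq = contradiction (sym eq) Fin.fromℕ≢inject₁
  next-injective {suc i} {suc j} eq = cong suc (Fin.inject₁-injective eq)

  prev-next : ∀ i → prev (next i) ≡ i
  prev-next i = next-injective (next-prev (next i))

  -- From `i` the steps descend to `zero`, wrap round to the top, and descend again to any `j`.
  next-induction : (P : Fin (suc k) → Set) → (∀ i → P i → P (next i)) → ∀ {i} → P i → ∀ j → P j
  next-induction P step {i} Pi = >-weakInduction P (step zero P0) (step ∘ suc)
    where
    P0 : P zero
    P0 = <-weakInduction (λ i → P i → P zero) id (λ i h → h ∘ step (suc i)) i Pi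

next≢ : ∀ {k} (i : Fin (2 ℕ.+ k)) → next i ≢ i
next≢ zero    ()
next≢ (suc i) eq = ℕ.1+n≢n (sym (trans (sym (Fin.toℕ-inject₁ i)) (cong Fin.toℕ eq)))

next-next≢ : ∀ {k} (i : Fin (3 ℕ.+ k)) → next (next i) ≢ i
next-next≢ zero          ()
next-next≢ (suc zero)    ()
next-next≢ (suc (suc i)) eq = ℕ.m≢1+n+m (Fin.toℕ i) {n = 1} (begin
  Fin.toℕ i                        ≡⟨ Fin.toℕ-inject₁ i ⟨
  Fin.toℕ (inject₁ i)              ≡⟨ Fin.toℕ-inject₁ (inject₁ i) ⟨
  Fin.toℕ (inject₁ (inject₁ i))    ≡⟨ cong Fin.toℕ eq ⟩
  2 ℕ.+ Fin.toℕ i                  ∎)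
  where open ≡-Reasoning

-- Counting by indicators, and fibres of a map between finite sets

length-filter-∑ : {A : Set} {P : A → Set} (P? : Decidable P) (xs : List A) →
                  length (filter P? xs) ≡ ∑ xs (λ x → 1 whenℕ P? x)
length-filter-∑ P? xs = begin
  length (filter P? xs)              ≡⟨ ℕ.*-identityʳ _ ⟨
  length (filter P? xs) ℕ.* 1        ≡⟨ ⊗-ℕ (length (filter P? xs)) 1 ⟨
  length (filter P? xs) ℕ∑.⊗ 1       ≡⟨ ∑-const (filter P? xs) 1 ⟨
  ∑ (filter P? xs) (const 1)         ≡⟨ ℕ∑.∑-filter P? xs (const 1) ⟩
  ∑ xs (λ x → 1 whenℕ P? x)          ∎
  where open ≡-Reasoning

∑-allFin-1 : ∀ n → ∑ (allFin n) (const 1) ≡ n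
∑-allFin-1 n = begin
  ∑ (allFin n) (const 1)    ≡⟨ ∑-const (allFin n) 1 ⟩
  length (allFin n) ℕ∑.⊗ 1  ≡⟨ ⊗-ℕ (length (allFin n)) 1 ⟩
  length (allFin n) ℕ.* 1   ≡⟨ ℕ.*-identityʳ _ ⟩
  length (allFin n)         ≡⟨ length-tabulate id ⟩
  n                         ∎
  where open ≡-Reasoning

tabulate-linked : ∀ {A : Set} {R : Rel A 0ℓ} {z} {n} (f : Fin (suc n) → A) →
  (∀ i → R (f (inject₁ i)) (f (suc i))) → R (f (fromℕ n)) z → Linked R (tabulate f ∷ʳ z)
tabulate-linked {n = zero}  f _    last = last ∷ [-]
tabulate-linked {n = suc n} f step last = step zero ∷ tabulate-linked (f ∘ suc) (step ∘ suc) last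

fibre : ∀ {p k} → (Fin p → Fin k) → Fin k → ℕ
fibre {p} c i = ∑ (allFin p) (λ b → 1 whenℕ (c b Fin.≟ i))

∑-fibre : ∀ {p k} (c : Fin p → Fin k) → ∑ (allFin k) (fibre c) ≡ p
∑-fibre {p} {k} c = begin
  ∑ (allFin k) (fibre c)
    ≡⟨ ∑-comm (allFin k) (allFin p) (λ i b → 1 whenℕ (c b Fin.≟ i)) ⟩
  ∑ (allFin p) (λ b → ∑ (allFin k) (λ i → 1 whenℕ (c b Fin.≟ i)))
    ≡⟨ ∑-cong (allFin p) (λ b → trans
         (∑-cong (allFin k) (λ i → ℕ∑.when-cong 1 (c b Fin.≟ i) (i Fin.≟ c b) sym sym))
         (ℕ∑.∑-allFin-≟ 1 (c b))) ⟩
  ∑ (allFin p) (const 1)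
    ≡⟨ ∑-allFin-1 p ⟩
  p ∎
  where open ≡-Reasoning

-- A cycle of length 3 + r, with the pendant vertex b attached to c b

module Sun {r p : ℕ} (c : Fin p → Fin (3 ℕ.+ r)) where

  k : ℕ
  k = 3 ℕ.+ r

  Ring : Rel (Fin k) 0ℓ
  Ring i j = next i ≡ j ⊎ next j ≡ i

  Ring⇒ : ∀ {i j} → Ring i j → j ≡ next i ⊎ j ≡ prev i
  Ring⇒         (inj₁ refl) = inj₁ refl
  Ring⇒ {j = j} (inj₂ refl) = inj₂ (sym (prev-next j))

  Ring⇐ : ∀ {i j} → j ≡ next i ⊎ j ≡ prev i → Ring i j
  Ring⇐         (inj₁ refl) = inj₁ refl
  Ring⇐ {i = i} (inj₂ refl) = inj₂ (next-prev i)

  next≢prev : (i : Fin k) → next i ≢ prev i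
  next≢prev i eq = next-next≢ i (trans (cong next eq) (next-prev i))

  ring? : ∀ i j → Dec (Ring i j)
  ring? i j = next i Fin.≟ j ⊎-dec next j Fin.≟ i

  Link : Rel (Fin k ⊎ Fin p) 0ℓ
  Link (inj₁ i) (inj₁ j) = Ring i j
  Link (inj₁ i) (inj₂ b) = c b ≡ i
  Link (inj₂ b) (inj₁ i) = c b ≡ i
  Link (inj₂ _) (inj₂ _) = ⊥

  link? : ∀ x y → Dec (Link x y)
  link? (inj₁ i) (inj₁ j) = ring? i j
  link? (inj₁ i) (inj₂ b) = c b Fin.≟ i
  link? (inj₂ b) (inj₁ i) = c b Fin.≟ i
  link? (inj₂ _) (inj₂ _) = no id

  Link-sym : ∀ x y → Link x y → Link y x
  Link-sym (inj₁ i) (inj₁ j) = swap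
  Link-sym (inj₁ i) (inj₂ b) = id
  Link-sym (inj₂ b) (inj₁ i) = id
  Link-sym (inj₂ _) (inj₂ _) = id

  Link-irrefl : ∀ x → ¬ Link x x
  Link-irrefl (inj₁ i) = [ next≢ i , next≢ i ]′
  Link-irrefl (inj₂ _) = id

  sun : Graph (k ℕ.+ p)
  sun = record
    { Adj    = λ u v → Link (splitAt k u) (splitAt k v)
    ; adj?   = λ u v → link? (splitAt k u) (splitAt k v)
    ; symm   = λ {u} {v} → Link-sym (splitAt k u) (splitAt k v)
    ; irrefl = λ { {u} refl → Link-irrefl (splitAt k u) }
    }

  open Graph sun

  vertex : Fin k ⊎ Fin p → Fin (k ℕ.+ p)
  vertex = join k p

  Adj⇒Link : ∀ x y → Adj (vertex x) (vertex y) → Link x y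
  Adj⇒Link x y = subst₂ Link (Fin.splitAt-join k p x) (Fin.splitAt-join k p y)

  Link⇒Adj : ∀ x y → Link x y → Adj (vertex x) (vertex y)
  Link⇒Adj x y = subst₂ Link (sym (Fin.splitAt-join k p x)) (sym (Fin.splitAt-join k p y))

  -- Matching on this view replaces a vertex by the image of a ring position or of a pendant index,
  -- so that `Adj⇒Link` and `Link⇒Adj` apply to it.
  data VertexView : Fin (k ℕ.+ p) → Set where
    isVertex : ∀ x → VertexView (vertex x)

  vertexView : ∀ u → VertexView u
  vertexView u = subst VertexView (Fin.join-splitAt k p u) (isVertex (splitAt k u))

  degree-∑ : ∀ x → degree sun (vertex x) ≡
    ∑ (allFin k) (λ i → 1 whenℕ link? x (inj₁ i)) ℕ.+ ∑ (allFin p) (λ b → 1 whenℕ link? x (inj₂ b))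
  degree-∑ x = begin
    degree sun (vertex x)
      ≡⟨ length-filter-∑ (adj? (vertex x)) (allFin (k ℕ.+ p)) ⟩
    ∑ (allFin (k ℕ.+ p)) (λ v → 1 whenℕ adj? (vertex x) v)
      ≡⟨ ℕ∑.∑-allFin-+ k p (λ v → 1 whenℕ adj? (vertex x) v) ⟩
    ∑ (allFin k) (λ i → 1 whenℕ adj? (vertex x) (i ↑ˡ p)) ℕ.+
    ∑ (allFin p) (λ b → 1 whenℕ adj? (vertex x) (k ↑ʳ b))
      ≡⟨ cong₂ ℕ._+_ (∑-cong (allFin k) (λ i → to-link (inj₁ i)))
                     (∑-cong (allFin p) (λ b → to-link (inj₂ b))) ⟩
    ∑ (allFin k) (λ i → 1 whenℕ link? x (inj₁ i)) ℕ.+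
    ∑ (allFin p) (λ b → 1 whenℕ link? x (inj₂ b)) ∎
    where
    open ≡-Reasoning
    to-link : ∀ y → 1 whenℕ adj? (vertex x) (vertex y) ≡ 1 whenℕ link? x y
    to-link y = ℕ∑.when-cong 1 (adj? (vertex x) (vertex y)) (link? x y) (Adj⇒Link x y) (Link⇒Adj x y)

  ∑-ring : ∀ i → ∑ (allFin k) (λ j → 1 whenℕ ring? i j) ≡ 2
  ∑-ring i = begin
    ∑ (allFin k) (λ j → 1 whenℕ ring? i j)
      ≡⟨ ∑-cong (allFin k) two ⟩
    ∑ (allFin k) (λ j → 1 whenℕ (j Fin.≟ next i) ℕ.+ 1 whenℕ (j Fin.≟ prev i))
      ≡⟨ ℕ∑.∑-∙ (allFin k) (λ j → 1 whenℕ (j Fin.≟ next i)) (λ j → 1 whenℕ (j Fin.≟ prev i)) ⟩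
    ∑ (allFin k) (λ j → 1 whenℕ (j Fin.≟ next i)) ℕ.+ ∑ (allFin k) (λ j → 1 whenℕ (j Fin.≟ prev i))
      ≡⟨ cong₂ ℕ._+_ (ℕ∑.∑-allFin-≟ 1 (next i)) (ℕ∑.∑-allFin-≟ 1 (prev i)) ⟩
    2 ∎
    where
    open ≡-Reasoning
    two : ∀ j → 1 whenℕ ring? i j ≡ 1 whenℕ (j Fin.≟ next i) ℕ.+ 1 whenℕ (j Fin.≟ prev i)
    two j with j Fin.≟ next i | j Fin.≟ prev i
    ... | yes j≡ | yes j≡′ = contradiction (trans (sym j≡) j≡′) (next≢prev i)
    ... | yes j≡ | no _    = ℕ∑.when-yes 1 (ring? i j) (Ring⇐ (inj₁ j≡))
    ... | no _   | yes j≡  = ℕ∑.when-yes 1 (ring? i j) (Ring⇐ (inj₂ j≡))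
    ... | no j≢  | no j≢′  = ℕ∑.when-no 1 (ring? i j) ([ j≢ , j≢′ ]′ ∘ Ring⇒)

  degree-core : ∀ i → degree sun (i ↑ˡ p) ≡ 2 ℕ.+ fibre c i
  degree-core i = trans (degree-∑ (inj₁ i)) (cong (ℕ._+ fibre c i) (∑-ring i))

  degree-pendant : ∀ b → degree sun (k ↑ʳ b) ≡ 1
  degree-pendant b = trans (degree-∑ (inj₂ b)) (cong₂ ℕ._+_
    (trans (∑-cong (allFin k) (λ i → ℕ∑.when-cong 1 (c b Fin.≟ i) (i Fin.≟ c b) sym sym))
           (ℕ∑.∑-allFin-≟ 1 (c b)))
    (ℕ∑.∑-ε (allFin p)))

  sun-pendantCount : pendantCount sun ≡ p
  sun-pendantCount = begin
    pendantCount sun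
      ≡⟨ length-filter-∑ pendant? (allFin (k ℕ.+ p)) ⟩
    ∑ (allFin (k ℕ.+ p)) (λ u → 1 whenℕ pendant? u)
      ≡⟨ ℕ∑.∑-allFin-+ k p (λ u → 1 whenℕ pendant? u) ⟩
    ∑ (allFin k) (λ i → 1 whenℕ pendant? (i ↑ˡ p)) ℕ.+ ∑ (allFin p) (λ b → 1 whenℕ pendant? (k ↑ʳ b))
      ≡⟨ cong₂ ℕ._+_
           (∑-cong (allFin k) (λ i → ℕ∑.when-no 1 (pendant? (i ↑ˡ p)) (core-not-pendant i)))
           (∑-cong (allFin p) (λ b → ℕ∑.when-yes 1 (pendant? (k ↑ʳ b)) (degree-pendant b))) ⟩
    ∑ (allFin k) (const 0) ℕ.+ ∑ (allFin p) (const 1)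
      ≡⟨ cong₂ ℕ._+_ (ℕ∑.∑-ε (allFin k)) (∑-allFin-1 p) ⟩
    p ∎
    where
    open ≡-Reasoning
    pendant? : ∀ u → Dec (degree sun u ≡ 1)
    pendant? u = degree sun u ℕ.≟ 1
    core-not-pendant : ∀ i → degree sun (i ↑ˡ p) ≢ 1
    core-not-pendant i eq with trans (sym (degree-core i)) eq
    ... | ()

  ∑-weight-sun : (f : ℕ → ℚ) → ∑ℚ (allFin (k ℕ.+ p)) (f ∘ degree sun) ≡
    ∑ℚ (allFin k) (λ i → f (2 ℕ.+ fibre c i)) ℚ.+ p ⊗ f 1
  ∑-weight-sun f = trans (ℚ∑.∑-allFin-+ k p (f ∘ degree sun)) (cong₂ ℚ._+_
    (ℚ∑.∑-cong (allFin k) (λ i → cong f (degree-core i)))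
    (trans (ℚ∑.∑-cong (allFin p) (λ b → cong f (degree-pendant b)))
    (trans (ℚ∑.∑-const (allFin p) (f 1)) (cong (_⊗ f 1) (length-tabulate {n = p} id)))))

  centre : Fin (k ℕ.+ p)
  centre = zero ↑ˡ p

  core-reaches : ∀ i → Star Adj (i ↑ˡ p) centre
  core-reaches = <-weakInduction _ Star.ε
    (λ i path → Link⇒Adj (inj₁ (suc i)) (inj₁ (inject₁ i)) (inj₁ refl) ◅ path)

  reaches : ∀ u → Star Adj u centre
  reaches u with vertexView u
  ... | isVertex (inj₁ i) = core-reaches i
  ... | isVertex (inj₂ b) = Link⇒Adj (inj₂ b) (inj₁ (c b)) refl ◅ core-reaches (c b)

  sun-connected : Connected sun
  sun-connected u v = reaches u ◅◅ Star.reverse (λ {u} {v} → symm {u} {v}) (reaches v)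

  sun-cycle : Cycle sun
  sun-cycle = record
    { start    = centre
    ; vs       = tabulate (λ i → suc i ↑ˡ p)
    ; long     = ℕ.s≤s (ℕ.s≤s ℕ.z≤n)
    ; distinct = Unique.tabulate⁺ {f = _↑ˡ p} (Fin.↑ˡ-injective p _ _)
    ; closed   = tabulate-linked (_↑ˡ p)
        (λ i → Link⇒Adj (inj₁ (inject₁ i)) (inj₁ (suc i)) (inj₂ refl))
        (Link⇒Adj (inj₁ (fromℕ (2 ℕ.+ r))) (inj₁ zero) (inj₂ refl))
    }

  -- A description that mentions no cycle. Every cycle of the graph is shown to have exactly these
  -- edges, hence any two cycles agree.
  RingEdge : Rel (Fin (k ℕ.+ p)) 0ℓ
  RingEdge u v = ∃₂ λ i j → Ring i j × u ≡ i ↑ˡ p × v ≡ j ↑ˡ p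

  module _ (D : Cycle sun) where
    open Cycle D

    vertices : List (Fin (k ℕ.+ p))
    vertices = start ∷ vs

    -- A vertex on a cycle has two distinct neighbours there, while `b` is adjacent to `c b` alone.
    pendant∉ : ∀ b → k ↑ʳ b ∉ vertices
    pendant∉ b b∈ with two-neighbours D b∈
    ... | x , y , b∼x , b∼y , x≢y = x≢y (trans (only x (∼⇒Adj D b∼x)) (sym (only y (∼⇒Adj D b∼y))))
      where
      only : ∀ x → Adj (k ↑ʳ b) x → x ≡ c b ↑ˡ p
      only x bx with vertexView x
      ... | isVertex (inj₁ i)  = cong (_↑ˡ p) (sym (Adj⇒Link (inj₂ b) (inj₁ i) bx))
      ... | isVertex (inj₂ b′) = ⊥-elim (Adj⇒Link (inj₂ b) (inj₂ b′) bx)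

    ∼⇒RingEdge : ∀ {u v} → u ∼ v → RingEdge u v
    ∼⇒RingEdge {u} {v} u∼v with vertexView u | vertexView v
    ... | isVertex (inj₁ i) | isVertex (inj₁ j) =
      i , j , Adj⇒Link (inj₁ i) (inj₁ j) (∼⇒Adj D u∼v) , refl , refl
    ... | isVertex (inj₂ b) | _                 = contradiction (∼-∈ʳ D (∼-sym D u∼v)) (pendant∉ b)
    ... | isVertex (inj₁ _) | isVertex (inj₂ b) = contradiction (∼-∈ʳ D u∼v) (pendant∉ b)

    neighbour : ∀ i {x} → (i ↑ˡ p) ∼ x → x ≡ next i ↑ˡ p ⊎ x ≡ prev i ↑ˡ p
    neighbour i i∼x with ∼⇒RingEdge i∼x
    ... | i′ , j , ring , i≡i′ , refl with Fin.↑ˡ-injective p i i′ i≡i′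
    ...   | refl with Ring⇒ ring
    ...     | inj₁ refl = inj₁ refl
    ...     | inj₂ refl = inj₂ refl

    -- Two distinct neighbours chosen from `next i` and `prev i` are both of them. A cycle through
    -- `i` thus goes on to `next i`, and so round the whole ring.
    ∼-next : ∀ i → i ↑ˡ p ∈ vertices → (i ↑ˡ p) ∼ (next i ↑ˡ p)
    ∼-next i i∈ with two-neighbours D i∈
    ... | x , y , i∼x , i∼y , x≢y with neighbour i i∼x | neighbour i i∼y
    ...   | inj₁ refl | _         = i∼x
    ...   | inj₂ _    | inj₁ refl = i∼y
    ...   | inj₂ x≡   | inj₂ y≡   = contradiction (trans x≡ (sym y≡)) x≢y

    some-core : ∀ {u} → VertexView u → u ∈ vertices → ∃[ i ] i ↑ˡ p ∈ vertices
    some-core (isVertex (inj₁ i)) u∈ = i , u∈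
    some-core (isVertex (inj₂ b)) u∈ = contradiction u∈ (pendant∉ b)

    core∈ : ∀ i → i ↑ˡ p ∈ vertices
    core∈ = next-induction (λ i → i ↑ˡ p ∈ vertices) (λ i i∈ → ∼-∈ʳ D (∼-next i i∈)) 
      (proj₂ (some-core (vertexView start) (here refl)))

    RingEdge⇒∼ : ∀ {u v} → RingEdge u v → u ∼ v
    RingEdge⇒∼ (i , _ , inj₁ refl , refl , refl) = ∼-next i (core∈ i)
    RingEdge⇒∼ (_ , j , inj₂ refl , refl , refl) = ∼-sym D (∼-next j (core∈ j))

  sun-unicyclic : Unicyclic sun
  sun-unicyclic = record
    { connected = sun-connected
    ; cycle     = sun-cycle
    ; unique    = λ D u v → mk⇔
        (RingEdge⇒∼ sun-cycle ∘ ∼⇒RingEdge D) (RingEdge⇒∼ D ∘ ∼⇒RingEdge sun-cycle)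
    }

-- Distributing p pendant vertices evenly

Balanced : (k q p : ℕ) → Set
Balanced k q p = ∃[ c ] (∀ i → fibre {p} {k} c i ≡ q ⊎ fibre c i ≡ suc q)

balanced-≤ : ∀ {k p} → p ℕ.≤ k → Balanced k 0 p
balanced-≤ {k} {p} p≤k = c , small
  where
  c : Fin p → Fin k
  c b = Fin.inject≤ b p≤k
  small : ∀ i → fibre c i ≡ 0 ⊎ fibre c i ≡ 1
  small i with Fin.any? (λ b → c b Fin.≟ i)
  ... | no ∄b = inj₁ (trans
    (∑-cong (allFin p) (λ b → ℕ∑.when-no 1 (c b Fin.≟ i) (λ eq → ∄b (b , eq))))
    (ℕ∑.∑-ε (allFin p)))
  ... | yes (b , refl) = inj₂ (trans
    (∑-cong (allFin p) (λ b′ → ℕ∑.when-cong 1 (c b′ Fin.≟ c b) (b′ Fin.≟ b)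
      (Fin.inject≤-injective p≤k p≤k b′ b) (cong c)))
    (ℕ∑.∑-allFin-≟ 1 b))

-- One more round: `k` new pendant vertices, attached one to each place by `id`, raise every fibre
-- by one.
balanced-+ : ∀ {k q p} → Balanced k q p → Balanced k (suc q) (k ℕ.+ p)
balanced-+ {k} {q} {p} (c , near) = c′ , λ i →
  Sum.map (trans (fibre-c′ i) ∘ cong suc) (trans (fibre-c′ i) ∘ cong suc) (near i)
  where
  c′ : Fin (k ℕ.+ p) → Fin k
  c′ u = [ id , c ]′ (splitAt k u)
  fibre-c′ : ∀ i → fibre c′ i ≡ suc (fibre c i)
  fibre-c′ i = begin
    fibre c′ i
      ≡⟨ ℕ∑.∑-allFin-+ k p (λ u → 1 whenℕ (c′ u Fin.≟ i)) ⟩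
    ∑ (allFin k) (λ j → 1 whenℕ (c′ (j ↑ˡ p) Fin.≟ i)) ℕ.+
    ∑ (allFin p) (λ b → 1 whenℕ (c′ (k ↑ʳ b) Fin.≟ i))
      ≡⟨ cong₂ ℕ._+_
           (∑-cong (allFin k) (λ j → cong (λ x → 1 whenℕ ([ id , c ]′ x Fin.≟ i)) (Fin.splitAt-↑ˡ k j p)))
           (∑-cong (allFin p) (λ b → cong (λ x → 1 whenℕ ([ id , c ]′ x Fin.≟ i)) (Fin.splitAt-↑ʳ k p b))) ⟩
    ∑ (allFin k) (λ j → 1 whenℕ (j Fin.≟ i)) ℕ.+ fibre c i
      ≡⟨ cong (ℕ._+ fibre c i) (ℕ∑.∑-allFin-≟ 1 i) ⟩
    suc (fibre c i) ∎
    where open ≡-Reasoning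

balanced-* : ∀ {k r} → r ℕ.≤ k → ∀ q → Balanced k q (q ℕ.* k ℕ.+ r)
balanced-*         r≤k zero    = balanced-≤ r≤k
balanced-* {k} {r} r≤k (suc q) = subst (Balanced k (suc q)) (sym (ℕ.+-assoc k (q ℕ.* k) r))
  (balanced-+ (balanced-* r≤k q))

balanced-/ : ∀ k .{{_ : ℕ.NonZero k}} p → Balanced k (p / k) p
balanced-/ k p = subst (Balanced k (p / k))
  (trans (ℕ.+-comm (p / k ℕ.* k) (p % k)) (sym (ℕ.m≡m%n+[m/n]*n p k)))
  (balanced-* (ℕ.<⇒≤ (ℕ.m%n<n p k)) (p / k))

-- Separating the pendant vertices

-- The vertices themselves are forgotten: their number, the degree sum and every weight sum depend
-- only on the number of ones and the list of values `d − 2`. Quantifying over `f` lets one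
-- splitting serve all bases `q`.
record Excess {A : Set} (d : A → ℕ) (us : List A) (ones : ℕ) : Set where
  field
    excesses : List ℕ
    size     : length us ≡ ones ℕ.+ length excesses
    total    : ∑ us d ≡ ones ℕ.+ (2 ℕ.* length excesses ℕ.+ ∑ excesses id)
    weights  : ∀ f → ∑ℚ us (f ∘ d) ≡ ones ⊗ f 1 ℚ.+ ∑ℚ excesses (λ x → f (2 ℕ.+ x))

excess : {A : Set} (d : A → ℕ) → (∀ u → 1 ℕ.≤ d u) → (us : List A) →
         Excess d us (length (filter (λ u → d u ℕ.≟ 1) us))
excess d d≥1 [] = record { excesses = [] ; size = refl ; total = refl ; weights = λ f → refl }
excess d d≥1 (u ∷ us) = step (d u) refl (d≥1 u)
  where
  open Excess (excess d d≥1 us)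
  ones : ℕ
  ones = length (filter (λ u → d u ℕ.≟ 1) us)
  step : ∀ k → d u ≡ k → 1 ℕ.≤ k → Excess d (u ∷ us) (length (filter (λ u → d u ℕ.≟ 1) (u ∷ us)))
  step (suc zero) du≡1 _ rewrite du≡1 = record
    { excesses = excesses
    ; size     = cong suc size
    ; total    = trans (cong (ℕ._+ ∑ us d) du≡1) (cong suc total)
    ; weights  = λ f → trans (cong₂ ℚ._+_ (cong f du≡1) (weights f))
        (sym (ℚ.+-assoc (f 1) (ones ⊗ f 1) (∑ℚ excesses (λ x → f (2 ℕ.+ x)))))
    }
  step (suc (suc x)) du≡ _ rewrite du≡ = record
    { excesses = x ∷ excesses
    ; size     = trans (cong suc size) (sym (ℕ.+-suc ones (length excesses)))
    ; total    = trans (cong₂ ℕ._+_ du≡ total)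
        (solve 4 (λ x o l s → con 2 :+ x :+ (o :+ (con 2 :* l :+ s)) := o :+ (con 2 :* (con 1 :+ l) :+ (x :+ s)))
          refl x ones (length excesses) (∑ excesses id))
    ; weights  = λ f → trans (cong₂ ℚ._+_ (cong f du≡) (weights f))
        (swap-left (f (2 ℕ.+ x)) (ones ⊗ f 1) (∑ℚ excesses (λ x → f (2 ℕ.+ x))))
    }
    where open ℕ-Solver

module _ {n p N : ℕ} (n≡N+p : n ≡ N ℕ.+ p) (2≤n : 2 ℕ.≤ n)
         (G : Graph n) (unicyclic : Unicyclic G) (pendants : pendantCount G ≡ p) where
  open Unicyclic unicyclic using (connected)

  degreeExcess : Excess (degree G) (allFin n) p
  degreeExcess = subst (Excess (degree G) (allFin n)) pendants
    (excess (degree G) (degree≥1 2≤n G connected) (allFin n))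

  open Excess degreeExcess

  length-excesses : length excesses ≡ N
  length-excesses = ℕ.+-cancelˡ-≡ p (length excesses) N (begin
    p ℕ.+ length excesses  ≡⟨ size ⟨
    length (allFin n)      ≡⟨ length-tabulate id ⟩
    n                      ≡⟨ n≡N+p ⟩
    N ℕ.+ p                ≡⟨ ℕ.+-comm N p ⟩
    p ℕ.+ N                ∎)
    where open ≡-Reasoning

  ∑-excesses : ∑ excesses id ≡ p
  ∑-excesses = ℕ.+-cancelˡ-≡ (p ℕ.+ 2 ℕ.* N) (∑ excesses id) p (begin
    (p ℕ.+ 2 ℕ.* N) ℕ.+ ∑ excesses id                   ≡⟨ ℕ.+-assoc p (2 ℕ.* N) _ ⟩
    p ℕ.+ (2 ℕ.* N ℕ.+ ∑ excesses id)                   ≡⟨ cong (λ l → p ℕ.+ (2 ℕ.* l ℕ.+ ∑ excesses id)) length-excesses ⟨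
    p ℕ.+ (2 ℕ.* length excesses ℕ.+ ∑ excesses id)     ≡⟨ total ⟨
    ∑ (allFin n) (degree G)                             ≡⟨ ∑-degree G unicyclic ⟩
    2 ℕ.* n                                             ≡⟨ cong (2 ℕ.*_) n≡N+p ⟩
    2 ℕ.* (N ℕ.+ p)                                     ≡⟨ solve 2 (λ N p → con 2 :* (N :+ p) := (p :+ con 2 :* N) :+ p) refl N p ⟩
    (p ℕ.+ 2 ℕ.* N) ℕ.+ p                               ∎)
    where
    open ≡-Reasoning
    open ℕ-Solver

-- The index and its bounds at a rational base

SEIℚ : ∀ {n} → ℚ → Graph n → ℚ
SEIℚ q G = ∑ℚ (edges G) (λ (u , v) → q ^ℚ degree G u ℚ.+ q ^ℚ degree G v)

lowerℚ : ℚ → (N p m t : ℕ) → ℚ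
lowerℚ q N p m t = (t ℕ.* (m ℕ.+ 1)) ⊗ q ^ℚ (m ℕ.+ 1) ℚ.+ ((N ℕ.∸ t) ℕ.* m) ⊗ q ^ℚ m ℚ.+ p ⊗ q

upperℚ : ℚ → (N p : ℕ) → ℚ
upperℚ q N p = (p ℕ.+ 2) ⊗ q ^ℚ (p ℕ.+ 2) ℚ.+ ((N ℕ.∸ 1) ℕ.* 2) ⊗ q ^ℚ 2 ℚ.+ p ⊗ q

module _ (q : ℚ) where

  weight₂₊ : ℕ → ℚ
  weight₂₊ x = weight q (2 ℕ.+ x)

  SEIℚ-degrees : ∀ {n} (G : Graph n) → SEIℚ q G ≡ ∑ℚ (allFin n) (weight q ∘ degree G)
  SEIℚ-degrees G = ℚ∑.∑-edges G (λ u → q ^ℚ degree G u)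

  weight-1 : weight q 1 ≡ q
  weight-1 = trans (ℚ.+-identityʳ _) (ℚ.*-identityʳ q)

  ⊗-weight : ∀ k d → (k ℕ.* d) ⊗ q ^ℚ d ≡ k ⊗ weight q d
  ⊗-weight k d = sym (×-assocˡ (q ^ℚ d) k d)

  -- The parameter of `lowerℚ` is a degree, that of `balancedSum` an excess; hence the shift by 2.
  lowerℚ-balanced : ∀ N p m t → lowerℚ q N p (2 ℕ.+ m) t ≡ balancedSum weight₂₊ m t N ℚ.+ p ⊗ weight q 1
  lowerℚ-balanced N p m t = cong₂ ℚ._+_
    (trans (cong₂ ℚ._+_ (trans (⊗-weight t (2 ℕ.+ m ℕ.+ 1)) (cong (λ d → t ⊗ weight q d) (ℕ.+-comm (2 ℕ.+ m) 1)))
                        (⊗-weight (N ℕ.∸ t) (2 ℕ.+ m)))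
           (ℚ.+-comm (t ⊗ weight₂₊ (suc m)) ((N ℕ.∸ t) ⊗ weight₂₊ m)))
    (cong (p ⊗_) (sym weight-1))

  upperℚ-weights : ∀ N p → upperℚ q N p ≡ weight₂₊ p ℚ.+ (N ℕ.∸ 1) ⊗ weight₂₊ 0 ℚ.+ p ⊗ weight q 1
  upperℚ-weights N p = cong₂ ℚ._+_
    (cong₂ ℚ._+_ (cong (weight q) (ℕ.+-comm p 2)) (⊗-weight (N ℕ.∸ 1) 2))
    (cong (p ⊗_) (sym weight-1))

division : ∀ p N .{{_ : ℕ.NonZero N}} → p ≡ p % N ℕ.+ N ℕ.* (p / N)
division p N = trans (ℕ.m≡m%n+[m/n]*n p N) (cong (p % N ℕ.+_) (ℕ.*-comm (p / N) N))

module _ {n p N : ℕ} .{{_ : ℕ.NonZero N}} (n≡N+p : n ≡ N ℕ.+ p) (2≤n : 2 ℕ.≤ n)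
         (G : Graph n) (unicyclic : Unicyclic G) (pendants : pendantCount G ≡ p)
         {q : ℚ} (admissible : Admissible q) where
  open Excess (degreeExcess {N = N} n≡N+p 2≤n G unicyclic pendants)

  private
    |xs|≡N : length excesses ≡ N
    |xs|≡N = length-excesses {N = N} n≡N+p 2≤n G unicyclic pendants

    ∑xs≡p : ∑ excesses id ≡ p
    ∑xs≡p = ∑-excesses {N = N} n≡N+p 2≤n G unicyclic pendants

    convex : Convex (weight₂₊ q)
    convex = weight-convex admissible

    SEIℚ≡ : SEIℚ q G ≡ ∑ℚ excesses (weight₂₊ q) ℚ.+ p ⊗ weight q 1
    SEIℚ≡ = trans (SEIℚ-degrees q G) (trans (weights (weight q)) (ℚ.+-comm (p ⊗ weight q 1) (∑ℚ excesses (weight₂₊ q))))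

  -- The average excess `p` over `N` lies between `p / N` and the next integer, the two points where
  -- the supporting line at `p / N` touches.
  SEIℚ-lower : lowerℚ q N p (2 ℕ.+ p / N) (p % N) ℚ.≤ SEIℚ q G
  SEIℚ-lower = subst₂ ℚ._≤_ (sym (lowerℚ-balanced q N p (p / N) (p % N))) (sym SEIℚ≡)
    (ℚ.+-monoˡ-≤ (p ⊗ weight q 1)
      (subst (λ l → balancedSum (weight₂₊ q) (p / N) (p % N) l ℚ.≤ ∑ℚ excesses (weight₂₊ q)) |xs|≡N
        (∑-convex-lower id (weight₂₊ q) (p / N) (p % N) excesses
          (subst (p % N ℕ.≤_) (sym |xs|≡N) (ℕ.<⇒≤ (ℕ.m%n<n p N)))
          (trans ∑xs≡p (trans (division p N) (cong (λ l → p % N ℕ.+ l ℕ.* (p / N)) (sym |xs|≡N))))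
          convex)))

  SEIℚ-upper : SEIℚ q G ℚ.≤ upperℚ q N p
  SEIℚ-upper = subst₂ ℚ._≤_ (sym SEIℚ≡) (sym (upperℚ-weights q N p))
    (ℚ.+-monoˡ-≤ (p ⊗ weight q 1) (begin
      ∑ℚ excesses (weight₂₊ q)                           ≡⟨ cancel (weight₂₊ q 0) _ ⟨
      (weight₂₊ q 0 ℚ.+ ∑ℚ excesses (weight₂₊ q)) ℚ.- weight₂₊ q 0     ≤⟨ ℚ.+-monoˡ-≤ (ℚ.- weight₂₊ q 0) (∑-convex-upper id (weight₂₊ q) convex excesses) ⟩
      (weight₂₊ q (∑ excesses id) ℚ.+ length excesses ⊗ weight₂₊ q 0) ℚ.- weight₂₊ q 0
        -- As `N` is nonzero, one of its `N` copies of `weight₂₊ q 0` cancels the subtracted one and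
        -- `N ∸ 1` remain.
        ≡⟨ cong₂ (λ s l → (weight₂₊ q s ℚ.+ l ⊗ weight₂₊ q 0) ℚ.- weight₂₊ q 0) ∑xs≡p (trans |xs|≡N (sym (ℕ.suc-pred N))) ⟩
      (weight₂₊ q p ℚ.+ (weight₂₊ q 0 ℚ.+ (N ℕ.∸ 1) ⊗ weight₂₊ q 0)) ℚ.- weight₂₊ q 0
        ≡⟨ regroup (weight₂₊ q p) (weight₂₊ q 0) ((N ℕ.∸ 1) ⊗ weight₂₊ q 0) ⟩
      weight₂₊ q p ℚ.+ (N ℕ.∸ 1) ⊗ weight₂₊ q 0 ∎))
    where
    open ℚ.≤-Reasoning
    cancel : ∀ a b → (a ℚ.+ b) ℚ.- a ≡ b
    cancel = solve 2 (λ a b → (a :+ b) :- a := b) refl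
      where open +-*-Solver
    regroup : ∀ a b c → (a ℚ.+ (b ℚ.+ c)) ℚ.- b ≡ a ℚ.+ c
    regroup = solve 3 (λ a b c → (a :+ (b :+ c)) :- b := a :+ c) refl
      where open +-*-Solver

-- The extremal graphs

module _ {r p : ℕ} (c : Fin p → Fin (3 ℕ.+ r)) where

  SEIℚ-sun : ∀ q → SEIℚ q (Sun.sun c) ≡ ∑ℚ (allFin (3 ℕ.+ r)) (weight₂₊ q ∘ fibre c) ℚ.+ p ⊗ weight q 1
  SEIℚ-sun q = trans (SEIℚ-degrees q (Sun.sun c)) (Sun.∑-weight-sun c (weight q))

lower-attained : ∀ r p → let N = 3 ℕ.+ r in
  ∃[ G ] (Unicyclic G × pendantCount {N ℕ.+ p} G ≡ p ×
          (∀ q → SEIℚ q G ≡ lowerℚ q N p (2 ℕ.+ p / N) (p % N)))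
lower-attained r p with balanced-/ (3 ℕ.+ r) p
... | c , near = Sun.sun c , Sun.sun-unicyclic c , Sun.sun-pendantCount c , λ q → begin
  SEIℚ q (Sun.sun c)
    ≡⟨ SEIℚ-sun c q ⟩
  ∑ℚ (allFin N) (weight₂₊ q ∘ fibre c) ℚ.+ p ⊗ weight q 1
    ≡⟨ cong (ℚ._+ p ⊗ weight q 1) (∑-balanced (fibre c) (weight₂₊ q) (p / N) (p % N) (allFin N)
         (subst (p % N ℕ.≤_) (sym |allFin|) (ℕ.<⇒≤ (ℕ.m%n<n p N)))
         (trans (∑-fibre c) (trans (division p N) (cong (λ l → p % N ℕ.+ l ℕ.* (p / N)) (sym |allFin|))))
         near) ⟩
  balancedSum (weight₂₊ q) (p / N) (p % N) (length (allFin N)) ℚ.+ p ⊗ weight q 1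
    ≡⟨ cong (λ l → balancedSum (weight₂₊ q) (p / N) (p % N) l ℚ.+ p ⊗ weight q 1) |allFin| ⟩
  balancedSum (weight₂₊ q) (p / N) (p % N) N ℚ.+ p ⊗ weight q 1
    ≡⟨ lowerℚ-balanced q N p (p / N) (p % N) ⟨
  lowerℚ q N p (2 ℕ.+ p / N) (p % N) ∎
  where
  open ≡-Reasoning
  N = 3 ℕ.+ r
  |allFin| : length (allFin N) ≡ N
  |allFin| = length-tabulate {n = N} id

upper-attained : ∀ r p → let N = 3 ℕ.+ r in
  ∃[ G ] (Unicyclic G × pendantCount {N ℕ.+ p} G ≡ p × (∀ q → SEIℚ q G ≡ upperℚ q N p))
upper-attained r p = Sun.sun c , Sun.sun-unicyclic c , Sun.sun-pendantCount c , λ q → begin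
  SEIℚ q (Sun.sun c)
    ≡⟨ SEIℚ-sun c q ⟩
  ∑ℚ (allFin (3 ℕ.+ r)) (weight₂₊ q ∘ fibre c) ℚ.+ p ⊗ weight q 1
    ≡⟨ cong (ℚ._+ p ⊗ weight q 1) (ℚ∑.∑-allFin-suc (2 ℕ.+ r) (weight₂₊ q ∘ fibre c)) ⟩
  weight₂₊ q (fibre c zero) ℚ.+ ∑ℚ (allFin (2 ℕ.+ r)) (λ i → weight₂₊ q (fibre c (suc i))) ℚ.+ p ⊗ weight q 1
    ≡⟨ cong₂ (λ a b → a ℚ.+ b ℚ.+ p ⊗ weight q 1) (cong (weight₂₊ q) (∑-allFin-1 p))
         (trans (ℚ∑.∑-cong (allFin (2 ℕ.+ r)) (λ i → cong (weight₂₊ q) (ℕ∑.∑-ε (allFin p))))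
         (trans (ℚ∑.∑-const (allFin (2 ℕ.+ r)) (weight₂₊ q 0))
                (cong (_⊗ weight₂₊ q 0) (length-tabulate {n = 2 ℕ.+ r} id)))) ⟩
  weight₂₊ q p ℚ.+ (2 ℕ.+ r) ⊗ weight₂₊ q 0 ℚ.+ p ⊗ weight q 1
    ≡⟨ upperℚ-weights q (3 ℕ.+ r) p ⟨
  upperℚ q (3 ℕ.+ r) p ∎
  where
  open ≡-Reasoning
  c : Fin p → Fin (3 ℕ.+ r)
  c _ = zero

-- Passing to the reals term by term

seq-· : ∀ k x i → seq (k · x) i ≡ k ⊗ seq x i
seq-· zero    x i = refl
seq-· (suc k) x i = cong (seq x i ℚ.+_) (seq-· k x i)

seq-^ : ∀ x k i → seq (x ^ k) i ≡ seq x i ^ℚ k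
seq-^ x zero    i = refl
seq-^ x (suc k) i = cong (seq x i ℚ.*_) (seq-^ x k i)

seq-sum : {A : Set} (xs : List A) (h : A → ℝ) (h′ : A → ℚ) → ∀ i → (∀ x → seq (h x) i ≡ h′ x) →
          seq (foldr _+ℝ_ 0ℝ (map h xs)) i ≡ ∑ℚ xs h′
seq-sum []       h h′ i eq = refl
seq-sum (x ∷ xs) h h′ i eq = cong₂ ℚ._+_ (eq x) (seq-sum xs h h′ i eq)

seq-SEI : ∀ {n} a (G : Graph n) i → seq (SEI a G) i ≡ SEIℚ (seq a i) G
seq-SEI a G i = seq-sum (edges G) _ _ i
  (λ (u , v) → cong₂ ℚ._+_ (seq-^ a (degree G u) i) (seq-^ a (degree G v) i))

seq-·^ : ∀ k a d i → seq (k · a ^ d) i ≡ k ⊗ seq a i ^ℚ d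
seq-·^ k a d i = trans (seq-· k (a ^ d) i) (cong (k ⊗_) (seq-^ a d i))

Lower : ℝ → (N p m t : ℕ) → ℝ
Lower a N p m t = (t ℕ.* (m ℕ.+ 1)) · a ^ (m ℕ.+ 1) +ℝ ((N ℕ.∸ t) ℕ.* m) · a ^ m +ℝ p · a

Upper : ℝ → (N p : ℕ) → ℝ
Upper a N p = (p ℕ.+ 2) · a ^ (p ℕ.+ 2) +ℝ ((N ℕ.∸ 1) ℕ.* 2) · a ^ 2 +ℝ p · a

seq-Lower : ∀ a N p m t i → seq (Lower a N p m t) i ≡ lowerℚ (seq a i) N p m t
seq-Lower a N p m t i = cong₂ ℚ._+_
  (cong₂ ℚ._+_ (seq-·^ (t ℕ.* (m ℕ.+ 1)) a (m ℕ.+ 1) i) (seq-·^ ((N ℕ.∸ t) ℕ.* m) a m i)) (seq-· p a i)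

seq-Upper : ∀ a N p i → seq (Upper a N p) i ≡ upperℚ (seq a i) N p
seq-Upper a N p i = cong₂ ℚ._+_
  (cong₂ ℚ._+_ (seq-·^ (p ℕ.+ 2) a (p ℕ.+ 2) i) (seq-·^ ((N ℕ.∸ 1) ℕ.* 2) a 2 i)) (seq-· p a i)

≡⇒≈ℝ : ∀ {x y} → (∀ i → seq x i ≡ seq y i) → x ≈ℝ y
≡⇒≈ℝ {x} {y} eq ε 0<ε = 0 , λ i _ → subst (ℚ._< ε)
  (sym (cong ℚ.∣_∣ (trans (cong (ℚ._- seq y i) (eq i)) (ℚ.+-inverseʳ (seq y i))))) 0<ε

≤⇒≤ℝ : ∀ {x y} M → (∀ i → M ℕ.≤ i → seq x i ℚ.≤ seq y i) → x ≤ℝ y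
≤⇒≤ℝ {x} {y} M x≤y ε 0<ε = M , λ i M≤i → ℚ.≤-<-trans (x≤y i M≤i)
  (subst (ℚ._< seq y i ℚ.+ ε) (ℚ.+-identityʳ (seq y i)) (ℚ.+-monoʳ-< (seq y i) 0<ε))

-- The witness of `0<e` has `δ = 1`, so `recip` inverts the maximum of its argument with 1. The
-- number 5/2 is the partial sum `1 + 1 + 1/2` of the series for `e`, reached at index 2.
recip-≤ : ∀ {x} → ℤ.+ 5 ℚ./ 2 ℚ.≤ x → recip (ℚ.positive⁻¹ 1ℚ) x ℚ.≤ ℤ.+ 2 ℚ./ 5
recip-≤ {x} 5/2≤x = begin
  v                                        ≡⟨ ℚ.*-identityʳ v ⟨
  v ℚ.* (ℤ.+ 5 ℚ./ 2 ℚ.* (ℤ.+ 2 ℚ./ 5))    ≡⟨ ℚ.*-assoc v (ℤ.+ 5 ℚ./ 2) (ℤ.+ 2 ℚ./ 5) ⟨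
  v ℚ.* (ℤ.+ 5 ℚ./ 2) ℚ.* (ℤ.+ 2 ℚ./ 5)    ≤⟨ ℚ.*-monoʳ-≤-nonNeg (ℤ.+ 2 ℚ./ 5)
    (ℚ.*-monoˡ-≤-nonNeg v {{ℚ.pos⇒nonNeg v {{ℚ.1/pos⇒pos u}}}} (ℚ.≤-trans 5/2≤x (ℚ.p≤p⊔q x 1ℚ))) ⟩
  v ℚ.* u ℚ.* (ℤ.+ 2 ℚ./ 5)                ≡⟨ cong (ℚ._* (ℤ.+ 2 ℚ./ 5)) (ℚ.*-inverseˡ u) ⟩
  1ℚ ℚ.* (ℤ.+ 2 ℚ./ 5)                     ≡⟨⟩
  ℤ.+ 2 ℚ./ 5                              ∎
  where
  open ℚ.≤-Reasoning
  u v : ℚ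
  u = x ℚ.⊔ 1ℚ
  instance
    u-pos : ℚ.Positive u
    u-pos = ℚ.positive (ℚ.<-≤-trans (ℚ.positive⁻¹ 1ℚ) (ℚ.p≤q⊔p x 1ℚ))
    u≢0 : ℚ.NonZero u
    u≢0 = ⊔-nonZero (ℚ.positive⁻¹ 1ℚ) x
  v = recip (ℚ.positive⁻¹ 1ℚ) x

e⁻¹-≤ : ∀ i → 2 ℕ.≤ i → seq e⁻¹ i ℚ.≤ ℤ.+ 2 ℚ./ 5
e⁻¹-≤ i 2≤i = recip-≤ (ℚ.≤-trans (ℚ.≤-reflexive refl) (e-mono (ℕ.≤⇒≤′ 2≤i)))

-- Since d qᵈ is convex on d ≥ 2 as soon as q ≤ ½, the crude bound e⁻¹ ≤ 2/5 leaves room for the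
-- error term 1/10.
eventually-admissible : ∀ a → (1ℝ <ℝ a) ⊎ (0ℝ <ℝ a × a ≤ℝ e⁻¹) →
                        ∃[ M ] (∀ i → M ℕ.≤ i → Admissible (seq a i))
eventually-admissible a (inj₁ (δ , 0<δ , M , 1+δ≤a)) = M , λ i M≤i →
  let 1≤a = ℚ.≤-trans (subst (ℚ._≤ 1ℚ ℚ.+ δ) (ℚ.+-identityʳ 1ℚ) (ℚ.+-monoʳ-≤ 1ℚ (ℚ.<⇒≤ 0<δ))) (1+δ≤a i M≤i)
  in ℚ.≤-trans (ℚ.nonNegative⁻¹ 1ℚ) 1≤a , inj₁ 1≤a
eventually-admissible a (inj₂ ((δ , 0<δ , K , δ≤a) , a≤e⁻¹)) with a≤e⁻¹ (ℤ.+ 1 ℚ./ 10) (ℚ.positive⁻¹ _)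
... | L , a<e⁻¹+ε = K ℕ.⊔ (L ℕ.⊔ 2) , λ i M≤i →
  let K≤i = ℕ.m⊔n≤o⇒m≤o K (L ℕ.⊔ 2) M≤i
      L⊔2≤i = ℕ.m⊔n≤o⇒n≤o K (L ℕ.⊔ 2) M≤i
  in ℚ.≤-trans (ℚ.<⇒≤ 0<δ) (subst (ℚ._≤ seq a i) (ℚ.+-identityˡ δ) (δ≤a i K≤i))
   , inj₂ (ℚ.≤-trans (ℚ.<⇒≤ (a<e⁻¹+ε i (ℕ.m⊔n≤o⇒m≤o L 2 L⊔2≤i)))
       (ℚ.+-monoˡ-≤ (ℤ.+ 1 ℚ./ 10) (e⁻¹-≤ i (ℕ.m⊔n≤o⇒n≤o L 2 L⊔2≤i))))

-- The parameters `m` and `t` in terms of division of `p` by `n − p`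

module _ {n p N : ℕ} .{{_ : ℕ.NonZero N}} (n≡N+p : n ≡ N ℕ.+ p) where

  2n∸p : 2 ℕ.* n ℕ.∸ p ≡ p ℕ.+ 2 ℕ.* N
  2n∸p = begin
    2 ℕ.* n ℕ.∸ p                    ≡⟨ cong (λ n → 2 ℕ.* n ℕ.∸ p) n≡N+p ⟩
    2 ℕ.* (N ℕ.+ p) ℕ.∸ p            ≡⟨ cong (ℕ._∸ p) (solve 2 (λ N p → con 2 :* (N :+ p) := (p :+ con 2 :* N) :+ p) refl N p) ⟩
    (p ℕ.+ 2 ℕ.* N) ℕ.+ p ℕ.∸ p      ≡⟨ ℕ.m+n∸n≡m (p ℕ.+ 2 ℕ.* N) p ⟩
    p ℕ.+ 2 ℕ.* N                    ∎
    where
    open ≡-Reasoning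
    open ℕ-Solver

  quotient : (2 ℕ.* n ℕ.∸ p) / N ≡ 2 ℕ.+ p / N
  quotient = begin
    (2 ℕ.* n ℕ.∸ p) / N              ≡⟨ cong (_/ N) 2n∸p ⟩
    (p ℕ.+ 2 ℕ.* N) / N              ≡⟨ ℕ.+-distrib-/-∣ʳ p (divides-refl 2) ⟩
    p / N ℕ.+ 2 ℕ.* N / N            ≡⟨ cong (p / N ℕ.+_) (ℕ.m*n/n≡m 2 N) ⟩
    p / N ℕ.+ 2                      ≡⟨ ℕ.+-comm (p / N) 2 ⟩
    2 ℕ.+ p / N                      ∎
    where open ≡-Reasoning

  remainder : (2 ℕ.* n ℕ.∸ p) ℕ.∸ (2 ℕ.* n ℕ.∸ p) / N ℕ.* N ≡ p % N
  remainder = begin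
    (2 ℕ.* n ℕ.∸ p) ℕ.∸ (2 ℕ.* n ℕ.∸ p) / N ℕ.* N  ≡⟨ ℕ.m%n≡m∸m/n*n (2 ℕ.* n ℕ.∸ p) N ⟨
    (2 ℕ.* n ℕ.∸ p) % N                            ≡⟨ cong (_% N) 2n∸p ⟩
    (p ℕ.+ 2 ℕ.* N) % N                            ≡⟨ ℕ.[m+kn]%n≡m%n p 2 N ⟩
    p % N                                          ∎
    where open ≡-Reasoning

-- The bounds for a real base, and their attainment

lower-bound : ∀ {n} (G : Graph n) N p m t a → (1ℝ <ℝ a) ⊎ (0ℝ <ℝ a × a ≤ℝ e⁻¹) →
  (∀ {q} → Admissible q → lowerℚ q N p m t ℚ.≤ SEIℚ q G) → Lower a N p m t ≤ℝ SEI a G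
lower-bound G N p m t a range bound =
  let (M , admissible) = eventually-admissible a range in
  ≤⇒≤ℝ {Lower a N p m t} {SEI a G} M (λ i M≤i →
    subst₂ ℚ._≤_ (sym (seq-Lower a N p m t i)) (sym (seq-SEI a G i)) (bound (admissible i M≤i)))

upper-bound : ∀ {n} (G : Graph n) N p a → (1ℝ <ℝ a) ⊎ (0ℝ <ℝ a × a ≤ℝ e⁻¹) →
  (∀ {q} → Admissible q → SEIℚ q G ℚ.≤ upperℚ q N p) → SEI a G ≤ℝ Upper a N p
upper-bound G N p a range bound =
  let (M , admissible) = eventually-admissible a range in
  ≤⇒≤ℝ {SEI a G} {Upper a N p} M (λ i M≤i →
    subst₂ ℚ._≤_ (sym (seq-SEI a G i)) (sym (seq-Upper a N p i)) (bound (admissible i M≤i)))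

lower-equality : ∀ {n} (G : Graph n) N p m t a →
  (∀ q → SEIℚ q G ≡ lowerℚ q N p m t) → SEI a G ≈ℝ Lower a N p m t
lower-equality G N p m t a eq = ≡⇒≈ℝ {SEI a G} {Lower a N p m t} (λ i →
  trans (seq-SEI a G i) (trans (eq (seq a i)) (sym (seq-Lower a N p m t i))))

upper-equality : ∀ {n} (G : Graph n) N p a →
  (∀ q → SEIℚ q G ≡ upperℚ q N p) → SEI a G ≈ℝ Upper a N p
upper-equality G N p a eq = ≡⇒≈ℝ {SEI a G} {Upper a N p} (λ i →
  trans (seq-SEI a G i) (trans (eq (seq a i)) (sym (seq-Upper a N p i))))

-- Matching on the two hypotheses brings the number of vertices into the form `(3 + r) + p`, on
-- which the graph is built.
lowerSun : ∀ {n p N} .{{_ : ℕ.NonZero N}} → n ≡ N ℕ.+ p → 3 ℕ.≤ N →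
  ∃[ G ] (Unicyclic G × pendantCount {n} G ≡ p × (∀ q → SEIℚ q G ≡ lowerℚ q N p (2 ℕ.+ p / N) (p % N)))
lowerSun {p = p} refl (ℕ.s≤s (ℕ.s≤s (ℕ.s≤s (ℕ.z≤n {r})))) = lower-attained r p

upperSun : ∀ {n p N} → n ≡ N ℕ.+ p → 3 ℕ.≤ N →
  ∃[ G ] (Unicyclic G × pendantCount {n} G ≡ p × (∀ q → SEIℚ q G ≡ upperℚ q N p))
upperSun {p = p} refl (ℕ.s≤s (ℕ.s≤s (ℕ.s≤s (ℕ.z≤n {r})))) = upper-attained r p

-- Here `m` and `t` are variables tied to division by equations. The rewriting then happens in the
-- rational statements only, and the real expressions keep the form in which they are stated.
bounds-attained : ∀ {n p N m t} .{{_ : ℕ.NonZero N}} →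
  n ≡ N ℕ.+ p → 3 ℕ.≤ N → m ≡ 2 ℕ.+ p / N → t ≡ p % N →
  (a : ℝ) → (1ℝ <ℝ a) ⊎ (0ℝ <ℝ a × a ≤ℝ e⁻¹) →
  ((G : Graph n) → Unicyclic G → pendantCount G ≡ p →
     Lower a N p m t ≤ℝ SEI a G × SEI a G ≤ℝ Upper a N p)
  × (∃[ G ] (Unicyclic G × pendantCount {n} G ≡ p × SEI a G ≈ℝ Lower a N p m t))
  × (∃[ G ] (Unicyclic G × pendantCount {n} G ≡ p × SEI a G ≈ℝ Upper a N p))
bounds-attained {n} {p} {N} {m} {t} n≡N+p 3≤N m≡ t≡ a range =
  (λ G unicyclic pendants →
    lower-bound G N p m t a range (λ {q} admissible →
      subst₂ (λ m t → lowerℚ q N p m t ℚ.≤ SEIℚ q G) (sym m≡) (sym t≡)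
        (SEIℚ-lower n≡N+p 2≤n G unicyclic pendants admissible)) ,
    upper-bound G N p a range (SEIℚ-upper n≡N+p 2≤n G unicyclic pendants)) ,
  (let (G , unicyclic , pendants , eq) = lowerSun n≡N+p 3≤N in
    G , unicyclic , pendants , lower-equality G N p m t a (λ q →
      subst₂ (λ m t → SEIℚ q G ≡ lowerℚ q N p m t) (sym m≡) (sym t≡) (eq q))) ,
  (let (G , unicyclic , pendants , eq) = upperSun n≡N+p 3≤N in
    G , unicyclic , pendants , upper-equality G N p a eq)
  where
  2≤n : 2 ℕ.≤ n
  2≤n = ℕ.≤-trans (ℕ.n≤1+n 2) (ℕ.≤-trans 3≤N (subst (N ℕ.≤_) (sym n≡N+p) (ℕ.m≤m+n N p)))

theorem5p6 : (n p : ℕ) (4≤n : 4 ≤ n) (1≤p : 1 ≤ p) (p≤n∸3 : p ≤ n ∸ 3)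
  (a : ℝ) → (1ℝ <ℝ a) ⊎ (0ℝ <ℝ a × a ≤ℝ e⁻¹) →
  let m = ((2 * n ∸ p) / (n ∸ p)) {{n∸p-nonZero 4≤n p≤n∸3}}
      t = (2 * n ∸ p) ∸ m * (n ∸ p)
      lower = (t * (m + 1)) · a ^ (m + 1) +ℝ ((n ∸ p ∸ t) * m) · a ^ m +ℝ p · a
      upper = (p + 2) · a ^ (p + 2) +ℝ ((n ∸ p ∸ 1) * 2) · a ^ 2 +ℝ p · a
  in
  ((G : Graph n) → Unicyclic G → pendantCount G ≡ p →
     lower ≤ℝ SEI a G × SEI a G ≤ℝ upper)
  × (∃[ G ] (Unicyclic G × pendantCount {n} G ≡ p × SEI a G ≈ℝ lower))
  × (∃[ G ] (Unicyclic G × pendantCount {n} G ≡ p × SEI a G ≈ℝ upper))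
theorem5p6 n p 4≤n 1≤p p≤n∸3 =
  bounds-attained {{N≢0}} n≡N+p 3≤n∸p (quotient {{N≢0}} n≡N+p) (remainder {{N≢0}} n≡N+p)
  where
  N≢0 : ℕ.NonZero (n ℕ.∸ p)
  N≢0 = n∸p-nonZero 4≤n p≤n∸3
  p+3≤n : p ℕ.+ 3 ℕ.≤ n
  p+3≤n = ℕ.m≤o∸n⇒m+n≤o p (ℕ.≤-trans (ℕ.n≤1+n 3) 4≤n) p≤n∸3
  3≤n∸p : 3 ℕ.≤ n ℕ.∸ p
  3≤n∸p = ℕ.m+n≤o⇒m≤o∸n 3 (subst (ℕ._≤ n) (ℕ.+-comm p 3) p+3≤n)
  n≡N+p : n ≡ n ℕ.∸ p ℕ.+ p
  n≡N+p = sym (ℕ.m∸n+n≡m (ℕ.≤-trans (ℕ.m≤m+n p 3) p+3≤n))
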